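{- There exists a $1$-consistent and $2$-robust algorithm for the MST problem under explorable uncertainty with predictions on instances that are prediction mandatory free and have a unique lower limit tree $T_L$ and a unique upper limit tree $T_U$ with $T_L=T_U$.
   Context: MST problem under explorable uncertainty with predictions: a connected (multi)graph $G=(V,E)$; each edge $e$ has unknown true weight $w_e\in\mathbb{R}_+$ and known uncertainty interval $I_e$, either open $(L_e,U_e)\ni w_e$ or trivial $\{w_e\}$ (then $L_e=U_e=w_e$). Querying $e$ reveals $w_e$. $Q\subseteq E$ is a feasible query set if some spanning tree is a minimum spanning tree for every weight assignment equal to $w_e$ on $Q$ and arbitrary in $I_e$ outside $Q$; $\mathrm{OPT}$ is a minimum-cardinality feasible query set. The algorithm queries adaptively until its query set $\mathrm{ALG}$ is feasible, and receives predictions $\hat w_e\in I_e$. $\rho$-competitive: $|\mathrm{ALG}|\le\rho|\mathrm{OPT}|$ on every instance (of the considered class); $\alpha$-consistent: $\alpha$-competitive when all predictions are correct; $\beta$-robust: $\beta$-competitive regardless of predictions. A lower limit tree $T_L$ is a minimum spanning tree for the weights $L_e+\epsilon$ with infinitesimally small $\epsilon>0$; an upper limit tree $T_U$ is a minimum spanning tree for the weights $U_e-\epsilon$. An edge is prediction mandatory if it belongs to every feasible query set under the hypothesis that all true values equal the predictions; an instance is prediction mandatory free if it has no prediction mandatory edge.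
   Formalization: The true weights, predictions, interval limits, and the weight assignments and ε used to define feasibility and limit trees are rational numbers instead of real numbers. -}

module Defs where

open import Data.Nat as ℕ using (ℕ; zero; suc)
open import Data.Fin using (Fin; zero; suc)
open import Data.Fin.Subset using (Subset; ⊤; ⊥; ⁅_⁆; _∈_; _∉_; _∪_; _─_; ∣_∣)
open import Data.Rational using (ℚ; 0ℚ; _+_; _-_; _≤_; _<_)
open import Data.Bool using (Bool; true; false; if_then_else_)
open import Data.Vec using (Vec; []; _∷_)
open import Data.Product using (Σ; _×_; _,_; proj₁; proj₂)
open import Data.Sum using (_⊎_)
open import Data.List using (List; []; _∷_; _++_; [_]; length; foldr)
open import Data.Maybe using (Maybe; just; nothing)
open import Function using (_∘_)
open import Relation.Binary.PropositionalEquality using (_≡_)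
open import Relation.Nullary using (¬_)

-- Instances: a (multi)graph with vertex set Fin n and edge set Fin m,
-- each edge with endpoints and an uncertainty interval that is either
-- trivial {L e} (L e = U e) or open (L e , U e) with L e < U e.
-- True weights and predictions are NOT part of the instance.

record Instance (n m : ℕ) : Set where
  field
    endpoints   : Fin m → Fin n × Fin n
    trivial     : Fin m → Bool
    L U         : Fin m → ℚ
    trivial-LU  : ∀ e → trivial e ≡ true → L e ≡ U e
    open-LU     : ∀ e → trivial e ≡ false → L e < U e

module _ {n m : ℕ} (G : Instance n m) where
  open Instance G

  InInterval : Fin m → ℚ → Set
  InInterval e x = (trivial e ≡ true × x ≡ L e)
                 ⊎ (trivial e ≡ false × (L e < x × x < U e))

  Valid : (Fin m → ℚ) → Set
  Valid x = ∀ e → InInterval e (x e)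

  Joins : Fin m → Fin n → Fin n → Set
  Joins e x y = (proj₁ (endpoints e) ≡ x × proj₂ (endpoints e) ≡ y)
              ⊎ (proj₁ (endpoints e) ≡ y × proj₂ (endpoints e) ≡ x)

  data Reach (S : Subset m) : Fin n → Fin n → Set where
    here : ∀ {x} → Reach S x x
    step : ∀ {x y z} (e : Fin m) → e ∈ S → Joins e x y → Reach S y z → Reach S x z

  Connected : Subset m → Set
  Connected S = ∀ x y → Reach S x y

  -- spanning tree: connected, spanning, and acyclic (every edge of S is
  -- a bridge of S: its endpoints are not connected in S minus that edge)
  IsSpanningTree : Subset m → Set
  IsSpanningTree S =
    Connected S ×
    (∀ e → e ∈ S → ¬ Reach (S ─ ⁅ e ⁆) (proj₁ (endpoints e)) (proj₂ (endpoints e)))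

  weight : (Fin m → ℚ) → Subset m → ℚ
  weight = go
    where
    go : ∀ {k} → (Fin k → ℚ) → Subset k → ℚ
    go x []       = 0ℚ
    go x (b ∷ S)  = (if b then x zero else 0ℚ) + go (x ∘ suc) S

  IsMST : (Fin m → ℚ) → Subset m → Set
  IsMST x T = IsSpanningTree T × (∀ T' → IsSpanningTree T' → weight x T ≤ weight x T')

  Feasible : (Fin m → ℚ) → Subset m → Set
  Feasible w Q = Σ (Subset m) λ T →
    ∀ (x : Fin m → ℚ) →
      (∀ e → e ∈ Q → x e ≡ w e) →
      (∀ e → e ∉ Q → InInterval e (x e)) →
      IsMST x T

  lowerW : ℚ → Fin m → ℚ
  lowerW ε e = if trivial e then L e else L e + ε

  upperW : ℚ → Fin m → ℚ
  upperW ε e = if trivial e then U e else U e - ε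

  IsLowerLimitTree : Subset m → Set
  IsLowerLimitTree T = Σ ℚ λ δ → 0ℚ < δ × (∀ ε → 0ℚ < ε → ε < δ → IsMST (lowerW ε) T)

  IsUpperLimitTree : Subset m → Set
  IsUpperLimitTree T = Σ ℚ λ δ → 0ℚ < δ × (∀ ε → 0ℚ < ε → ε < δ → IsMST (upperW ε) T)

  UniqueLowerLimitTree : Subset m → Set
  UniqueLowerLimitTree T = IsLowerLimitTree T × (∀ T' → IsLowerLimitTree T' → T' ≡ T)

  UniqueUpperLimitTree : Subset m → Set
  UniqueUpperLimitTree T = IsUpperLimitTree T × (∀ T' → IsUpperLimitTree T' → T' ≡ T)

  PredictionMandatory : (Fin m → ℚ) → Fin m → Set
  PredictionMandatory ŵ e = ∀ Q → Feasible ŵ Q → e ∈ Q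

  PredictionMandatoryFree : (Fin m → ℚ) → Set
  PredictionMandatoryFree ŵ = ∀ e → ¬ PredictionMandatory ŵ e

  InClass : (Fin m → ℚ) → Set
  InClass ŵ = Connected ⊤ × PredictionMandatoryFree ŵ ×
              Σ (Subset m) λ T → UniqueLowerLimitTree T × UniqueUpperLimitTree T

-- Adaptive deterministic algorithms.  Given the instance, the predictions
-- and the history of (queried edge , revealed value) pairs, the algorithm
-- either queries an edge (just e) or stops (nothing).

History : ℕ → Set
History m = List (Fin m × ℚ)

Algorithm : Set
Algorithm = ∀ {n m} → Instance n m → (Fin m → ℚ) → History m → Maybe (Fin m)

module _ {n m : ℕ} (A : Algorithm) (G : Instance n m) (ŵ w : Fin m → ℚ) where

  extend : History m → Maybe (Fin m) → History m
  extend h nothing  = h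
  extend h (just e) = h ++ [ (e , w e) ]

  run : ℕ → History m
  run zero    = []
  run (suc k) = extend (run k) (A G ŵ (run k))

  queried : History m → Subset m
  queried = foldr (λ p S → ⁅ proj₁ p ⁆ ∪ S) ⊥

  -- A reaches a feasible query set after some number of rounds, having made
  -- at most ρ · |OPT| queries (i.e. at most ρ · |Q| for every feasible Q)
  Competitive : ℕ → Set
  Competitive ρ = Σ ℕ λ k →
    Feasible G w (queried (run k)) ×
    (∀ Q → Feasible G w Q → length (run k) ℕ.≤ ρ ℕ.* ∣ Q ∣)

{-# OPTIONS --safe #-}
module Submission where

-- Fix a tree T that is optimal for both the lower and the upper limits. A tree edge e and a non-tree edge f conflict if e lies
-- on the cycle of f and L f < U e. Without prediction mandatory edges, ŵ f ≥ U e and ŵ e ≤ L f for every conflict, so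
-- querying a vertex cover of the (bipartite) conflict graph suffices if it turns out to be correctly predicted. By König's theorem some
-- cover C is matched injectively into its complement. Query C by decreasing upper limits on the tree side and by increasing
-- lower limits on the other: as long as the predictions are correct, each p ∈ C and its partner form a witness set, that is, a
-- set hit by every feasible query set. At the first wrong prediction query the partners of all queried elements and then
-- repeatedly a witness set of at most two edges of the revealed instance. All witness sets are disjoint, so the cost is at most
-- |OPT| if the predictions are correct and 2 |OPT| in general.

open import Defs
open import Data.Bool using (Bool; true; false; if_then_else_)
open import Data.Fin using (Fin; zero; suc; _≟_)
open import Data.Fin.Properties using (any?; all?)
open import Data.Fin.Subset
open import Data.Fin.Subset.Properties
open import Data.List using (List; []; _∷_; [_]; map; _++_; allFin; length; foldr)
import Data.List.Membership.Propositional as List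
open import Data.List.Membership.Propositional.Properties using (∈-++⁺ˡ; ∈-++⁺ʳ; ∈-map⁺; ∈-allFin)
open import Data.List.Properties using (++-assoc; ++-identityʳ)
open import Data.List.Relation.Unary.Any using (here; there)
open import Data.Maybe using (Maybe; just; nothing)
open import Data.Nat as ℕ using (ℕ; zero; suc; z≤n; s≤s)
import Data.Nat.Properties as ℕ
open import Data.Product as Product using (Σ; ∃; _×_; _,_; proj₁; proj₂)
open import Data.Rational as ℚ using (ℚ; 0ℚ; 1ℚ; _+_; _≤_; _<_)
open import Data.Rational.Properties
  using (≤-refl; ≤-reflexive; ≤-trans; ≤-total; <⇒≤; ≰⇒>; ≮⇒≥; <-irrefl; <-trans; <-≤-trans; ≤-<-trans; <-dense; _≤?_; _<?_;
         neg-antimono-<; +-assoc; +-identityʳ; +-inverseʳ; +-monoˡ-≤; +-monoʳ-≤; +-monoʳ-<; +-monoˡ-<)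
  renaming (_≟_ to _≟ℚ_)
open import Data.Rational.Solver using (module +-*-Solver)
open import Data.Sum as Sum using (_⊎_; inj₁; inj₂; [_,_]′)
open import Data.Vec using ([]; _∷_; tabulate; here; there)
open import Data.Vec.Properties using (lookup⇒[]=; []=⇒lookup; lookup∘tabulate)
open import Function using (_∘_; id)
open import Relation.Binary.PropositionalEquality
  using (_≡_; _≢_; refl; sym; trans; cong; subst; subst₂; module ≡-Reasoning)
open import Relation.Nullary using (¬_; Dec; yes; no; does; contradiction; _×-dec_; _⊎-dec_; _→-dec_; ¬?)
open import Relation.Nullary.Decidable using (map′; from-yes; toSum; dec-true)
open import Relation.Unary using (Decidable)

-- A correct value at either end of a conflict settles it: ŵ e ≤ L f puts e below the whole interval
-- of f, and U e ≤ ŵ f puts f above the whole interval of e. The obstacle is the lower bound on OPT,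
-- which must charge p before it is known whether its own prediction holds. A pair is a witness set
-- only if p is extremal among the edges in conflict with its partner. The partner lies outside C,
-- so all of these lie in C; those more extreme than p come earlier in the order, and their correct
-- values move them out of the way. Thus even the first mispredicted p is charged, and the factor 2
-- is one query for p and one deferred query for its partner. After a failure T may cease to be
-- optimal, so trees are recomputed.
--
-- Of spanning trees only the symmetric exchange property and decidability enter these arguments,
-- which are therefore carried out for abstract bases. The infinitesimals of the limit trees become
-- decidable orders on intervals, so that a search over all edge sets can find T.

minimiser : {A B : Set} (_≲_ : B → B → Set) → (∀ x y → x ≲ y ⊎ y ≲ x) → (∀ {x y z} → x ≲ y → y ≲ z → x ≲ z) →
  (f : A → B) {P : A → Set} → Decidable P → (xs : List A) →
  (∃ λ a → P a × (∀ {b} → b List.∈ xs → P b → f a ≲ f b)) ⊎ (∀ {b} → b List.∈ xs → ¬ P b)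
minimiser _≲_ total ≲-trans f P? [] = inj₂ λ ()
minimiser _≲_ total ≲-trans f P? (x ∷ xs) with P? x | minimiser _≲_ total ≲-trans f P? xs
... | no ¬px | inj₂ none = inj₂ λ { (here refl) → ¬px ; (there b∈) → none b∈ }
... | no ¬px | inj₁ (a , pa , least) =
  inj₁ (a , pa , λ { (here refl) pb → contradiction pb ¬px ; (there b∈) pb → least b∈ pb })
... | yes px | inj₂ none =
  inj₁ (x , px , λ { (here refl) _ → [ id , id ]′ (total _ _) ; (there b∈) pb → contradiction pb (none b∈) })
... | yes px | inj₁ (a , pa , least) with total (f x) (f a)
...   | inj₁ x≲a = inj₁ (x , px , λ { (here refl) _ → [ id , id ]′ (total _ _) ; (there b∈) pb → ≲-trans x≲a (least b∈ pb) })
...   | inj₂ a≲x = inj₁ (a , pa , λ { (here refl) _ → a≲x ; (there b∈) pb → least b∈ pb })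

-- Finite subsets: enumeration and cardinality.

subsets : ∀ m → List (Subset m)
subsets zero    = [ [] ]
subsets (suc m) = map (inside ∷_) (subsets m) ++ map (outside ∷_) (subsets m)

∈-subsets : ∀ {m} (S : Subset m) → S List.∈ subsets m
∈-subsets []          = here refl
∈-subsets (true ∷ S)  = ∈-++⁺ˡ (∈-map⁺ (inside ∷_) (∈-subsets S))
∈-subsets (false ∷ S) = ∈-++⁺ʳ (map (inside ∷_) (subsets _)) (∈-map⁺ (outside ∷_) (∈-subsets S))

x∈p─q⇒x∉q : ∀ {m} {x : Fin m} (p q : Subset m) → x ∈ p ─ q → x ∉ q
x∈p─q⇒x∉q (_ ∷ p) (_ ∷ q)     (there x∈) (there x∈q) = x∈p─q⇒x∉q p q x∈ x∈q
x∈p─q⇒x∉q (_ ∷ p) (true ∷ q)  () here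

x∈p-y⇒x≢y : ∀ {m} {x : Fin m} (p : Subset m) y → x ∈ p - y → x ≢ y
x∈p-y⇒x≢y p y x∈ refl = x∈p─q⇒x∉q p ⁅ y ⁆ x∈ (x∈⁅x⁆ y)

x∈p-y⇒x∈p : ∀ {m} {x : Fin m} (p : Subset m) y → x ∈ p - y → x ∈ p
x∈p-y⇒x∈p p y = p─q⊆p p ⁅ y ⁆

⟦_⟧ : ∀ {m} {P : Fin m → Set} → Decidable P → Subset m
⟦ P? ⟧ = tabulate (does ∘ P?)

module _ {m} {P : Fin m → Set} (P? : Decidable P) where

  ∈⟦⟧⁺ : ∀ {x} → P x → x ∈ ⟦ P? ⟧
  ∈⟦⟧⁺ {x} px = lookup⇒[]= x _ (trans (lookup∘tabulate (does ∘ P?) x) (dec-true (P? x) px))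

  ∈⟦⟧⁻ : ∀ {x} → x ∈ ⟦ P? ⟧ → P x
  ∈⟦⟧⁻ {x} x∈ with P? x | trans (sym (lookup∘tabulate (does ∘ P?) x)) ([]=⇒lookup x∈)
  ... | yes px | _ = px
  ... | no _   | ()

∣p∪q∣+∣p∩q∣≡∣p∣+∣q∣ : ∀ {m} (p q : Subset m) → ∣ p ∪ q ∣ ℕ.+ ∣ p ∩ q ∣ ≡ ∣ p ∣ ℕ.+ ∣ q ∣
∣p∪q∣+∣p∩q∣≡∣p∣+∣q∣ [] [] = refl
∣p∪q∣+∣p∩q∣≡∣p∣+∣q∣ (true ∷ p)  (true ∷ q)  =
  cong suc (trans (ℕ.+-suc _ _) (trans (cong suc (∣p∪q∣+∣p∩q∣≡∣p∣+∣q∣ p q)) (sym (ℕ.+-suc _ _))))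
∣p∪q∣+∣p∩q∣≡∣p∣+∣q∣ (true ∷ p)  (false ∷ q) = cong suc (∣p∪q∣+∣p∩q∣≡∣p∣+∣q∣ p q)
∣p∪q∣+∣p∩q∣≡∣p∣+∣q∣ (false ∷ p) (true ∷ q)  = trans (cong suc (∣p∪q∣+∣p∩q∣≡∣p∣+∣q∣ p q)) (sym (ℕ.+-suc _ _))
∣p∪q∣+∣p∩q∣≡∣p∣+∣q∣ (false ∷ p) (false ∷ q) = ∣p∪q∣+∣p∩q∣≡∣p∣+∣q∣ p q

∣p∪q∣≤∣p∣+∣q∣ : ∀ {m} (p q : Subset m) → ∣ p ∪ q ∣ ℕ.≤ ∣ p ∣ ℕ.+ ∣ q ∣
∣p∪q∣≤∣p∣+∣q∣ p q = ℕ.≤-trans (ℕ.m≤m+n _ _) (ℕ.≤-reflexive (∣p∪q∣+∣p∩q∣≡∣p∣+∣q∣ p q))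

Empty⇒∣p∣≡0 : ∀ {m} {p : Subset m} → Empty p → ∣ p ∣ ≡ 0
Empty⇒∣p∣≡0 {m} p∅ = trans (cong ∣_∣ (Empty-unique p∅)) (∣⊥∣≡0 m)

disjoint⇒∣p∣+∣q∣≤∣r∣ : ∀ {m} {p q r : Subset m} → p ⊆ r → q ⊆ r → (∀ {x} → x ∈ p → x ∉ q) → ∣ p ∣ ℕ.+ ∣ q ∣ ℕ.≤ ∣ r ∣
disjoint⇒∣p∣+∣q∣≤∣r∣ {p = p} {q} {r} p⊆r q⊆r disj = begin
  ∣ p ∣ ℕ.+ ∣ q ∣            ≡⟨ sym (∣p∪q∣+∣p∩q∣≡∣p∣+∣q∣ p q) ⟩
  ∣ p ∪ q ∣ ℕ.+ ∣ p ∩ q ∣    ≡⟨ cong (∣ p ∪ q ∣ ℕ.+_) (Empty⇒∣p∣≡0 λ (x , x∈) → disj (proj₁ (x∈p∩q⁻ p q x∈)) (proj₂ (x∈p∩q⁻ p q x∈))) ⟩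
  ∣ p ∪ q ∣ ℕ.+ 0            ≡⟨ ℕ.+-identityʳ _ ⟩
  ∣ p ∪ q ∣                  ≤⟨ p⊆q⇒∣p∣≤∣q∣ ([ p⊆r , q⊆r ]′ ∘ x∈p∪q⁻ p q) ⟩
  ∣ r ∣                      ∎
  where open ℕ.≤-Reasoning

0<∣p∣⇒Nonempty : ∀ {m} {p : Subset m} → 0 ℕ.< ∣ p ∣ → Nonempty p
0<∣p∣⇒Nonempty {p = p} 0<∣p∣ with nonempty? p
... | yes p≠∅ = p≠∅
... | no p∅   = contradiction (subst (0 ℕ.<_) (Empty⇒∣p∣≡0 p∅) 0<∣p∣) ℕ.n≮0

-- Hall's and König's theorems

module Hall {m} {_~_ : Fin m → Fin m → Set} (_~?_ : ∀ x y → Dec (x ~ y)) where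

  Neighbour : Subset m → Subset m → Fin m → Set
  Neighbour X Y y = y ∈ Y × ∃ λ x → x ∈ X × x ~ y

  neighbour? : ∀ X Y → Decidable (Neighbour X Y)
  neighbour? X Y y = (y ∈? Y) ×-dec any? λ x → (x ∈? X) ×-dec (x ~? y)

  N : Subset m → Subset m → Subset m
  N X Y = ⟦ neighbour? X Y ⟧

  HallCondition : Subset m → Subset m → Set
  HallCondition X Y = ∀ {R} → R ⊆ X → ∣ R ∣ ℕ.≤ ∣ N R Y ∣

  record Matching (X Y : Subset m) : Set where
    field
      partner   : Fin m → Fin m
      partner∈  : ∀ {x} → x ∈ X → partner x ∈ Y
      adjacent  : ∀ {x} → x ∈ X → x ~ partner x
      injective : ∀ {x y} → x ∈ X → y ∈ X → partner x ≡ partner y → x ≡ y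
  open Matching

  glue : ∀ {X Y X₁ Y₁ X₂ Y₂} → Matching X₁ Y₁ → Matching X₂ Y₂ →
    (∀ {x} → x ∈ X → x ∉ X₁ → x ∈ X₂) → Y₁ ⊆ Y → Y₂ ⊆ Y → (∀ {y} → y ∈ Y₁ → y ∉ Y₂) → Matching X Y
  glue {X} {Y} {X₁} M₁ M₂ rest Y₁⊆ Y₂⊆ disj = record
    { partner   = h
    ; partner∈  = h∈
    ; adjacent  = h~
    ; injective = inj
    }
    where
    h : Fin m → Fin m
    h x with x ∈? X₁
    ... | yes _ = partner M₁ x
    ... | no _  = partner M₂ x

    h∈ : ∀ {x} → x ∈ X → h x ∈ Y
    h∈ {x} x∈ with x ∈? X₁
    ... | yes x∈₁ = Y₁⊆ (partner∈ M₁ x∈₁)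
    ... | no x∉₁  = Y₂⊆ (partner∈ M₂ (rest x∈ x∉₁))

    h~ : ∀ {x} → x ∈ X → x ~ h x
    h~ {x} x∈ with x ∈? X₁
    ... | yes x∈₁ = adjacent M₁ x∈₁
    ... | no x∉₁  = adjacent M₂ (rest x∈ x∉₁)

    inj : ∀ {x y} → x ∈ X → y ∈ X → h x ≡ h y → x ≡ y
    inj {x} {y} x∈ y∈ eq with x ∈? X₁ | y ∈? X₁
    ... | yes x∈₁ | yes y∈₁ = injective M₁ x∈₁ y∈₁ eq
    ... | yes x∈₁ | no y∉₁  =
      contradiction (partner∈ M₂ (rest y∈ y∉₁)) (disj (subst (_∈ _) eq (partner∈ M₁ x∈₁)))
    ... | no x∉₁  | yes y∈₁ =
      contradiction (partner∈ M₂ (rest x∈ x∉₁)) (disj (subst (_∈ _) (sym eq) (partner∈ M₁ y∈₁)))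
    ... | no x∉₁  | no y∉₁  = injective M₂ (rest x∈ x∉₁) (rest y∈ y∉₁) eq

  matchPair : ∀ {x y} → x ~ y → Matching ⁅ x ⁆ ⁅ y ⁆
  matchPair {x} {y} x~y = record
    { partner   = λ _ → y
    ; partner∈  = λ _ → x∈⁅x⁆ y
    ; adjacent  = λ z∈ → subst (_~ y) (sym (x∈⁅y⁆⇒x≡y x z∈)) x~y
    ; injective = λ a∈ b∈ _ → trans (x∈⁅y⁆⇒x≡y x a∈) (sym (x∈⁅y⁆⇒x≡y x b∈))
    }

  -- Halmos–Vaughan: split at a nonempty set with no surplus of neighbours if there is one, and otherwise match any
  -- vertex to any of its neighbours.
  hall : ∀ k {X Y} → ∣ X ∣ ℕ.< k → HallCondition X Y → Matching X Y
  hall (suc k) {X} {Y} (s≤s ∣X∣≤k) hc with nonempty? X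
  ... | no X∅ = record
    { partner   = id
    ; partner∈  = λ x∈ → contradiction (_ , x∈) X∅
    ; adjacent  = λ x∈ → contradiction (_ , x∈) X∅
    ; injective = λ x∈ → contradiction (_ , x∈) X∅
    }
  ... | yes (x , x∈X) with anySubset? (λ R → (R ⊆? (X - x)) ×-dec (nonempty? R ×-dec (∣ N R Y ∣ ℕ.≤? ∣ R ∣)))
  ...   | yes (R , R⊆X-x , (r , r∈R) , tight) =
    glue (hall k ∣R∣<k inner) (hall k ∣X─R∣<k outer)
      (λ z∈ z∉ → x∈p∧x∉q⇒x∈p─q z∈ z∉) (proj₁ ∘ ∈⟦⟧⁻ (neighbour? R Y)) (p─q⊆p Y _)
      (λ y∈ y∈─ → x∈p─q⇒x∉q Y _ y∈─ y∈)
    where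
    R⊆X : R ⊆ X
    R⊆X = x∈p-y⇒x∈p X x ∘ R⊆X-x
    ∣R∣<k : ∣ R ∣ ℕ.< k
    ∣R∣<k = ℕ.≤-trans (ℕ.≤-<-trans (p⊆q⇒∣p∣≤∣q∣ R⊆X-x) (x∈p⇒∣p-x∣<∣p∣ x∈X)) ∣X∣≤k
    ∣X─R∣<k : ∣ X ─ R ∣ ℕ.< k
    ∣X─R∣<k = ℕ.≤-trans (p∩q≢∅⇒∣p─q∣<∣p∣ X R (r , x∈p∩q⁺ (R⊆X r∈R , r∈R))) ∣X∣≤k
    inner : HallCondition R (N R Y)
    inner {R'} R'⊆R = ℕ.≤-trans (hc (R⊆X ∘ R'⊆R)) (p⊆q⇒∣p∣≤∣q∣ λ y∈ →
      let (y∈Y , z , z∈R' , z~y) = ∈⟦⟧⁻ (neighbour? R' Y) y∈ in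
      ∈⟦⟧⁺ (neighbour? R' (N R Y)) (∈⟦⟧⁺ (neighbour? R Y) (y∈Y , z , R'⊆R z∈R' , z~y) , z , z∈R' , z~y))
    -- Hall's condition is applied to `R ∪ R'` and the tight `R` is cancelled, so the neighbours of
    -- `R'` outside `N R Y` must account for all of `R'`.
    outer : HallCondition (X ─ R) (Y ─ N R Y)
    outer {R'} R'⊆X─R = ℕ.+-cancelˡ-≤ ∣ R ∣ _ _ (begin
      ∣ R ∣ ℕ.+ ∣ R' ∣                          ≤⟨ disjoint⇒∣p∣+∣q∣≤∣r∣ (p⊆p∪q R') (q⊆p∪q R R') (λ z∈R z∈R' → x∈p─q⇒x∉q X R (R'⊆X─R z∈R') z∈R) ⟩
      ∣ R ∪ R' ∣                                ≤⟨ hc ([ R⊆X , p─q⊆p X R ∘ R'⊆X─R ]′ ∘ x∈p∪q⁻ R R') ⟩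
      ∣ N (R ∪ R') Y ∣                          ≤⟨ p⊆q⇒∣p∣≤∣q∣ cover ⟩
      ∣ N R Y ∪ N R' (Y ─ N R Y) ∣              ≤⟨ ∣p∪q∣≤∣p∣+∣q∣ (N R Y) _ ⟩
      ∣ N R Y ∣ ℕ.+ ∣ N R' (Y ─ N R Y) ∣        ≤⟨ ℕ.+-monoˡ-≤ _ tight ⟩
      ∣ R ∣ ℕ.+ ∣ N R' (Y ─ N R Y) ∣            ∎)
      where
      open ℕ.≤-Reasoning
      cover : N (R ∪ R') Y ⊆ N R Y ∪ N R' (Y ─ N R Y)
      cover {y} y∈ with ∈⟦⟧⁻ (neighbour? (R ∪ R') Y) y∈ | y ∈? N R Y
      ... | _ | yes y∈N = p⊆p∪q _ y∈N
      ... | y∈Y , z , z∈ , z~y | no y∉N with x∈p∪q⁻ R R' z∈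
      ...   | inj₁ z∈R  = contradiction (∈⟦⟧⁺ (neighbour? R Y) (y∈Y , z , z∈R , z~y)) y∉N
      ...   | inj₂ z∈R' = q⊆p∪q (N R Y) _ (∈⟦⟧⁺ (neighbour? R' _) (x∈p∧x∉q⇒x∈p─q y∈Y y∉N , z , z∈R' , z~y))
  ...   | no slack =
    glue (matchPair x~y) (hall k (ℕ.≤-trans (x∈p⇒∣p-x∣<∣p∣ x∈X) ∣X∣≤k) smaller)
      (λ z∈ z∉ → x∈p∧x∉q⇒x∈p─q z∈ z∉) (λ z∈ → subst (_∈ Y) (sym (x∈⁅y⁆⇒x≡y y z∈)) y∈Y) (x∈p-y⇒x∈p Y y)
      (λ z∈ z∈- → x∈p─q⇒x∉q Y _ z∈- z∈)
    where
    neighbour : Nonempty (N ⁅ x ⁆ Y)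
    neighbour = 0<∣p∣⇒Nonempty (ℕ.≤-trans (ℕ.≤-reflexive (sym (∣⁅x⁆∣≡1 x))) (hc λ z∈ → subst (_∈ X) (sym (x∈⁅y⁆⇒x≡y x z∈)) x∈X))
    y = proj₁ neighbour
    y∈Y = proj₁ (∈⟦⟧⁻ (neighbour? ⁅ x ⁆ Y) (proj₂ neighbour))
    x~y : x ~ y
    x~y = let (_ , z , z∈ , z~y) = ∈⟦⟧⁻ (neighbour? ⁅ x ⁆ Y) (proj₂ neighbour) in subst (_~ y) (x∈⁅y⁆⇒x≡y x z∈) z~y
    -- By `slack`, every nonempty `R` inside `X - x` has a neighbour to spare, which makes up for
    -- the loss of `y`.
    smaller : HallCondition (X - x) (Y - y)
    smaller {R} R⊆ with nonempty? R
    ... | no R∅   = ℕ.≤-trans (ℕ.≤-reflexive (Empty⇒∣p∣≡0 R∅)) z≤n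
    ... | yes R≠∅ = ℕ.+-cancelˡ-≤ 1 _ _ (begin
      1 ℕ.+ ∣ R ∣                       ≤⟨ ℕ.≰⇒> (λ tight → slack (R , R⊆ , R≠∅ , tight)) ⟩
      ∣ N R Y ∣                         ≤⟨ p⊆q⇒∣p∣≤∣q∣ cover ⟩
      ∣ ⁅ y ⁆ ∪ N R (Y - y) ∣           ≤⟨ ∣p∪q∣≤∣p∣+∣q∣ ⁅ y ⁆ _ ⟩
      ∣ ⁅ y ⁆ ∣ ℕ.+ ∣ N R (Y - y) ∣     ≡⟨ cong (ℕ._+ ∣ N R (Y - y) ∣) (∣⁅x⁆∣≡1 y) ⟩
      1 ℕ.+ ∣ N R (Y - y) ∣             ∎)
      where
      open ℕ.≤-Reasoning
      cover : N R Y ⊆ ⁅ y ⁆ ∪ N R (Y - y)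
      cover {z} z∈ with z ∈? ⁅ y ⁆ | ∈⟦⟧⁻ (neighbour? R Y) z∈
      ... | yes z∈y | _ = p⊆p∪q _ z∈y
      ... | no z∉y | z∈Y , adj = q⊆p∪q ⁅ y ⁆ _ (∈⟦⟧⁺ (neighbour? R _) (x∈p∧x∉q⇒x∈p─q z∈Y z∉y , adj))

record CoverWithMatching {m} (_~_ : Fin m → Fin m → Set) : Set where
  field
    C         : Subset m
    covers    : ∀ {x y} → x ~ y → x ∈ C ⊎ y ∈ C
    partner   : Fin m → Fin m
    partner∉  : ∀ {x} → x ∈ C → partner x ∉ C
    adjacent  : ∀ {x} → x ∈ C → x ~ partner x
    injective : ∀ {x y} → x ∈ C → y ∈ C → partner x ≡ partner y → x ≡ y

-- In a minimum cover each side satisfies Hall's condition towards the complement of the cover. `T`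
-- is one side of the bipartition, so the partners of `C ∩ T` lie outside `T` and those of `C ─ T`
-- inside it: the two matchings cannot collide.
könig : ∀ {m} {_~_ : Fin m → Fin m → Set} (_~?_ : ∀ x y → Dec (x ~ y)) (T : Subset m) →
  (∀ {x y} → x ~ y → y ~ x) → (∀ {x y} → x ~ y → x ∈ T → y ∉ T) → (∀ {x y} → x ~ y → x ∉ T → y ∈ T) →
  CoverWithMatching _~_
könig {m} {_~_} _~?_ T ~-sym T~∁T ∁T~T = record
  { C         = C
  ; covers    = λ {x} {y} → covers x y
  ; partner   = h
  ; partner∉  = λ {x} → h∉ {x}
  ; adjacent  = λ {x} → h~ {x}
  ; injective = λ {x} {y} → inj {x} {y}
  }
  where
  open Hall _~?_
  open Matching

  Cover : Subset m → Set
  Cover C = ∀ x y → x ~ y → x ∈ C ⊎ y ∈ C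

  cover? : Decidable Cover
  cover? C = all? λ x → all? λ y → (x ~? y) →-dec ((x ∈? C) ⊎-dec (y ∈? C))

  minimum : ∃ λ C → Cover C × (∀ {D} → D List.∈ subsets m → Cover D → ∣ C ∣ ℕ.≤ ∣ D ∣)
  minimum with minimiser ℕ._≤_ ℕ.≤-total ℕ.≤-trans ∣_∣ cover? (subsets m)
  ... | inj₁ found = found
  ... | inj₂ none  = contradiction (λ _ _ _ → inj₁ ∈⊤) (none (∈-subsets ⊤))

  C = proj₁ minimum
  covers = proj₁ (proj₂ minimum)

  -- Exchange argument: as no two elements of `R` are adjacent, replacing `R` by its neighbours
  -- outside `C` gives a cover again, and `C` is minimum.
  independent⇒Hall : ∀ {R} → R ⊆ C → (∀ {x y} → x ∈ R → y ∈ R → ¬ x ~ y) → ∣ R ∣ ℕ.≤ ∣ N R (∁ C) ∣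
  independent⇒Hall {R} R⊆C indep = ℕ.+-cancelˡ-≤ ∣ C ─ R ∣ _ _ (begin
    ∣ C ─ R ∣ ℕ.+ ∣ R ∣              ≤⟨ disjoint⇒∣p∣+∣q∣≤∣r∣ (p─q⊆p C R) R⊆C (x∈p─q⇒x∉q C R) ⟩
    ∣ C ∣                            ≤⟨ proj₂ (proj₂ minimum) (∈-subsets _) exchanged ⟩
    ∣ (C ─ R) ∪ N R (∁ C) ∣          ≤⟨ ∣p∪q∣≤∣p∣+∣q∣ (C ─ R) _ ⟩
    ∣ C ─ R ∣ ℕ.+ ∣ N R (∁ C) ∣      ∎)
    where
    open ℕ.≤-Reasoning
    retained : ∀ {x y} → x ~ y → x ∈ C → x ∈ (C ─ R) ∪ N R (∁ C) ⊎ y ∈ (C ─ R) ∪ N R (∁ C)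
    retained {x} {y} x~y x∈C with x ∈? R | y ∈? C
    ... | no x∉R  | _       = inj₁ (p⊆p∪q _ (x∈p∧x∉q⇒x∈p─q x∈C x∉R))
    ... | yes x∈R | yes y∈C = inj₂ (p⊆p∪q _ (x∈p∧x∉q⇒x∈p─q y∈C λ y∈R → indep x∈R y∈R x~y))
    ... | yes x∈R | no y∉C  = inj₂ (q⊆p∪q (C ─ R) _ (∈⟦⟧⁺ (neighbour? R (∁ C)) (x∉p⇒x∈∁p y∉C , x , x∈R , x~y)))
    exchanged : Cover ((C ─ R) ∪ N R (∁ C))
    exchanged x y x~y with covers x y x~y
    ... | inj₁ x∈C = retained x~y x∈C
    ... | inj₂ y∈C = Sum.swap (retained (~-sym x~y) y∈C)

  inT : Matching (C ∩ T) (∁ C)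
  inT = hall (suc ∣ C ∩ T ∣) ℕ.≤-refl λ R⊆ → independent⇒Hall (p∩q⊆p C T ∘ R⊆)
    λ x∈R y∈R x~y → T~∁T x~y (p∩q⊆q C T (R⊆ x∈R)) (p∩q⊆q C T (R⊆ y∈R))

  out : Matching (C ─ T) (∁ C)
  out = hall (suc ∣ C ─ T ∣) ℕ.≤-refl λ R⊆ → independent⇒Hall (p─q⊆p C T ∘ R⊆)
    λ x∈R y∈R x~y → x∈p─q⇒x∉q C T (R⊆ y∈R) (∁T~T x~y (x∈p─q⇒x∉q C T (R⊆ x∈R)))

  h : Fin m → Fin m
  h x with x ∈? T
  ... | yes _ = partner inT x
  ... | no _  = partner out x

  h∉ : ∀ {x} → x ∈ C → h x ∉ C
  h∉ {x} x∈C with x ∈? T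
  ... | yes x∈T = x∈∁p⇒x∉p (partner∈ inT (x∈p∩q⁺ (x∈C , x∈T)))
  ... | no x∉T  = x∈∁p⇒x∉p (partner∈ out (x∈p∧x∉q⇒x∈p─q x∈C x∉T))

  h~ : ∀ {x} → x ∈ C → x ~ h x
  h~ {x} x∈C with x ∈? T
  ... | yes x∈T = adjacent inT (x∈p∩q⁺ (x∈C , x∈T))
  ... | no x∉T  = adjacent out (x∈p∧x∉q⇒x∈p─q x∈C x∉T)

  inj : ∀ {x y} → x ∈ C → y ∈ C → h x ≡ h y → x ≡ y
  inj {x} {y} x∈C y∈C eq with x ∈? T | y ∈? T | h~ {x} x∈C | h~ {y} y∈C
  ... | yes x∈T | yes y∈T | _   | _   = injective inT (x∈p∩q⁺ (x∈C , x∈T)) (x∈p∩q⁺ (y∈C , y∈T)) eq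
  ... | yes x∈T | no y∉T  | x~h | y~h = contradiction (subst (_∈ T) (sym eq) (∁T~T y~h y∉T)) (T~∁T x~h x∈T)
  ... | no x∉T  | yes y∈T | x~h | y~h = contradiction (subst (_∈ T) eq (∁T~T x~h x∉T)) (T~∁T y~h y∈T)
  ... | no x∉T  | no y∉T  | _   | _   = injective out (x∈p∧x∉q⇒x∈p─q x∈C x∉T) (x∈p∧x∉q⇒x∈p─q y∈C y∉T) eq

-- Spanning trees

swap : ∀ {m} → Subset m → Fin m → Fin m → Subset m
swap T e f = (T - e) ∪ ⁅ f ⁆

module _ {m} {T : Subset m} {e f : Fin m} where

  ∈swap⁻ : ∀ {x} → x ∈ swap T e f → (x ∈ T × x ≢ e) ⊎ x ≡ f
  ∈swap⁻ = Sum.map (λ x∈ → x∈p-y⇒x∈p T e x∈ , x∈p-y⇒x≢y T e x∈) (x∈⁅y⁆⇒x≡y f) ∘ x∈p∪q⁻ (T - e) ⁅ f ⁆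

  f∈swap : f ∈ swap T e f
  f∈swap = q⊆p∪q (T - e) ⁅ f ⁆ (x∈⁅x⁆ f)

  ∈swap⁺ : ∀ {x} → x ∈ T → x ≢ e → x ∈ swap T e f
  ∈swap⁺ x∈T x≢e = p⊆p∪q ⁅ f ⁆ (x∈p∧x≢y⇒x∈p-y x∈T x≢e)

  e∉swap : e ≢ f → e ∉ swap T e f
  e∉swap e≢f e∈ with ∈swap⁻ e∈
  ... | inj₁ (_ , e≢e) = e≢e refl
  ... | inj₂ e≡f       = e≢f e≡f

∈∧∉⇒≢ : ∀ {m} {T : Subset m} {e f} → e ∈ T → f ∉ T → e ≢ f
∈∧∉⇒≢ e∈T f∉T refl = f∉T e∈T

module _ {n m} (G : Instance n m) where
  open Instance G

  src tgt : Fin m → Fin n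
  src = proj₁ ∘ endpoints
  tgt = proj₂ ∘ endpoints

  Reach-mono : ∀ {S S' x y} → S ⊆ S' → Reach G S x y → Reach G S' x y
  Reach-mono S⊆S' here             = here
  Reach-mono S⊆S' (step e e∈S J r) = step e (S⊆S' e∈S) J (Reach-mono S⊆S' r)

  Reach-trans : ∀ {S x y z} → Reach G S x y → Reach G S y z → Reach G S x z
  Reach-trans here             r' = r'
  Reach-trans (step e e∈S J r) r' = step e e∈S J (Reach-trans r r')

  Reach-edge : ∀ {S} e → e ∈ S → Reach G S (src e) (tgt e)
  Reach-edge e e∈S = step e e∈S (inj₁ (refl , refl)) here

  Reach-sym : ∀ {S x y} → Reach G S x y → Reach G S y x
  Reach-sym here             = here
  Reach-sym (step e e∈S J r) = Reach-trans (Reach-sym r) (step e e∈S (Sum.swap J) here)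

  Through : Subset m → Fin m → Fin n → Fin n → Set
  Through S e x y = (Reach G S x (src e) × Reach G S (tgt e) y) ⊎ (Reach G S x (tgt e) × Reach G S (src e) y)

  -- Whatever lies between the first and the last use of `e` can be cut out, so a walk needs `e` at
  -- most once.
  Reach-split : ∀ {S x y} e → Reach G S x y → Reach G (S - e) x y ⊎ Through (S - e) e x y
  Reach-split e here = inj₁ here
  Reach-split e (step f f∈S J r) with f ≟ e | J | Reach-split e r
  ... | yes refl | inj₁ (refl , refl) | inj₁ r'              = inj₂ (inj₁ (here , r'))
  ... | yes refl | inj₁ (refl , refl) | inj₂ (inj₁ (_ , r')) = inj₂ (inj₁ (here , r'))
  ... | yes refl | inj₁ (refl , refl) | inj₂ (inj₂ (_ , r')) = inj₁ r'
  ... | yes refl | inj₂ (refl , refl) | inj₁ r'              = inj₂ (inj₂ (here , r'))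
  ... | yes refl | inj₂ (refl , refl) | inj₂ (inj₁ (_ , r')) = inj₁ r'
  ... | yes refl | inj₂ (refl , refl) | inj₂ (inj₂ (_ , r')) = inj₂ (inj₂ (here , r'))
  ... | no f≢e   | J' | inj₁ r'              = inj₁ (step f (x∈p∧x≢y⇒x∈p-y f∈S f≢e) J' r')
  ... | no f≢e   | J' | inj₂ (inj₁ (r₁ , r₂)) = inj₂ (inj₁ (step f (x∈p∧x≢y⇒x∈p-y f∈S f≢e) J' r₁ , r₂))
  ... | no f≢e   | J' | inj₂ (inj₂ (r₁ , r₂)) = inj₂ (inj₂ (step f (x∈p∧x≢y⇒x∈p-y f∈S f≢e) J' r₁ , r₂))

  Through-join : ∀ {S e x y} → Through S e x y → Reach G S (src e) (tgt e) → Reach G S x y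
  Through-join (inj₁ (r₁ , r₂)) r = Reach-trans r₁ (Reach-trans r r₂)
  Through-join (inj₂ (r₁ , r₂)) r = Reach-trans r₁ (Reach-trans (Reach-sym r) r₂)

  Through-close : ∀ {S e x y} → Through S e x y → Reach G S x y → Reach G S (src e) (tgt e)
  Through-close (inj₁ (r₁ , r₂)) r = Reach-trans (Reach-sym r₁) (Reach-trans r (Reach-sym r₂))
  Through-close (inj₂ (r₁ , r₂)) r = Reach-trans r₂ (Reach-trans (Reach-sym r) r₁)

  Through-mono : ∀ {S S' e x y} → S ⊆ S' → Through S e x y → Through S' e x y
  Through-mono S⊆ = Sum.map (λ (r₁ , r₂) → Reach-mono S⊆ r₁ , Reach-mono S⊆ r₂) (λ (r₁ , r₂) → Reach-mono S⊆ r₁ , Reach-mono S⊆ r₂)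

  -- Deleting one edge reduces the question to five questions about a smaller edge set, by
  -- `Reach-split`.
  reach? : ∀ S x y → Dec (Reach G S x y)
  reach? S = go (suc ∣ S ∣) S ℕ.≤-refl
    where
    go : ∀ k S → ∣ S ∣ ℕ.< k → ∀ x y → Dec (Reach G S x y)
    go (suc k) S (s≤s ∣S∣≤k) x y with nonempty? S
    ... | no S∅ = map′ (λ { refl → here }) (λ { here → refl ; (step e e∈S _ _) → contradiction (e , e∈S) S∅ }) (x ≟ y)
    ... | yes (e , e∈S) = map′ [ Reach-mono S-e⊆S , (λ t → Through-join (Through-mono S-e⊆S t) (Reach-edge e e∈S)) ]′ (Reach-split e)
        (smaller x y ⊎-dec ((smaller x (src e) ×-dec smaller (tgt e) y) ⊎-dec (smaller x (tgt e) ×-dec smaller (src e) y)))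
      where
      smaller = go k (S - e) (ℕ.≤-trans (x∈p⇒∣p-x∣<∣p∣ e∈S) ∣S∣≤k)
      S-e⊆S : S - e ⊆ S
      S-e⊆S = x∈p-y⇒x∈p S e

  abstract
    isSpanningTree? : ∀ S → Dec (IsSpanningTree G S)
    isSpanningTree? S = (all? λ x → all? λ y → reach? S x y) ×-dec
      (all? λ e → (e ∈? S) →-dec ¬? (reach? (S - e) (src e) (tgt e)))

  -- `f` joins the two components of `T - e`, hence the ends of `e` are connected around `f`. If
  -- another edge `g` were no bridge, a walk around `g` would either avoid `f` and contradict `T`,
  -- or use `f` and then, closed up through `g`, join the ends of `f` inside `T - e`.
  swap-isSpanningTree : ∀ {T} e f → IsSpanningTree G T → e ∈ T → ¬ Reach G (T - e) (src f) (tgt f) → IsSpanningTree G (swap T e f)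
  swap-isSpanningTree {T} e f (conn , bridge) e∈T ¬r = conn' , bridge'
    where
    T-e⊆ : T - e ⊆ swap T e f
    T-e⊆ = p⊆p∪q ⁅ f ⁆
    aroundE : Reach G (swap T e f) (src e) (tgt e)
    aroundE with Reach-split e (conn (src f) (tgt f))
    ... | inj₁ r = contradiction r ¬r
    ... | inj₂ t = Through-close (Through-mono T-e⊆ t) (Reach-edge f f∈swap)
    conn' : Connected G (swap T e f)
    conn' x y with Reach-split e (conn x y)
    ... | inj₁ r = Reach-mono T-e⊆ r
    ... | inj₂ t = Through-join (Through-mono T-e⊆ t) aroundE
    bridge' : ∀ g → g ∈ swap T e f → ¬ Reach G (swap T e f - g) (src g) (tgt g)
    bridge' g g∈ r with g ≟ f | ∈swap⁻ {T = T} g∈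
    ... | yes refl | _ = ¬r (Reach-mono (λ x∈ →
        [ (λ (x∈T , x≢e) → x∈p∧x≢y⇒x∈p-y x∈T x≢e) , (λ x≡f → contradiction x≡f (x∈p-y⇒x≢y (swap T e f) f x∈)) ]′ (∈swap⁻ (x∈p-y⇒x∈p (swap T e f) f x∈))) r)
    ... | no g≢f   | inj₂ g≡f = g≢f g≡f
    ... | no g≢f   | inj₁ (g∈T , g≢e) with Reach-split f r
    ...   | inj₁ r' = bridge g g∈T (Reach-mono (λ x∈ → let (x∈T , _ , x≢g) = shrink x∈ in x∈p∧x≢y⇒x∈p-y x∈T x≢g) r')
      where
      shrink : ∀ {x} → x ∈ swap T e f - g - f → x ∈ T × x ≢ e × x ≢ g
      shrink {x} x∈ with ∈swap⁻ {T = T} (x∈p-y⇒x∈p (swap T e f) g (x∈p-y⇒x∈p (swap T e f - g) f x∈))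
      ... | inj₁ (x∈T , x≢e) = x∈T , x≢e , x∈p-y⇒x≢y (swap T e f) g (x∈p-y⇒x∈p (swap T e f - g) f x∈)
      ... | inj₂ x≡f         = contradiction x≡f (x∈p-y⇒x≢y (swap T e f - g) f x∈)
    ...   | inj₂ t = ¬r (Through-close (Through-mono shrink t) (Reach-edge g (x∈p∧x≢y⇒x∈p-y g∈T g≢e)))
      where
      shrink : swap T e f - g - f ⊆ T - e
      shrink {x} x∈ with ∈swap⁻ {T = T} (x∈p-y⇒x∈p (swap T e f) g (x∈p-y⇒x∈p (swap T e f - g) f x∈))
      ... | inj₁ (x∈T , x≢e) = x∈p∧x≢y⇒x∈p-y x∈T x≢e
      ... | inj₂ x≡f         = contradiction x≡f (x∈p-y⇒x≢y (swap T e f - g) f x∈)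

  -- An inclusion-minimal connecting edge set stands in for a simple path: what `exchange` needs of
  -- simplicity is that every edge is indispensable.
  minimalPath : ∀ {a b} S → Reach G S a b → ∃ λ P → P ⊆ S × Reach G P a b × (∀ {e} → e ∈ P → ¬ Reach G (P - e) a b)
  minimalPath {a} {b} S = go (suc ∣ S ∣) S ℕ.≤-refl
    where
    go : ∀ k S → ∣ S ∣ ℕ.< k → Reach G S a b → ∃ λ P → P ⊆ S × Reach G P a b × (∀ {e} → e ∈ P → ¬ Reach G (P - e) a b)
    go (suc k) S (s≤s ∣S∣≤k) r with any? (λ e → (e ∈? S) ×-dec reach? (S - e) a b)
    ... | no minimal = S , id , r , λ e∈S r' → minimal (_ , e∈S , r')
    ... | yes (e , e∈S , r') =
      let (P , P⊆ , rest) = go k (S - e) (ℕ.≤-trans (x∈p⇒∣p-x∣<∣p∣ e∈S) ∣S∣≤k) r' in P , x∈p-y⇒x∈p S e ∘ P⊆ , rest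

  crossing : ∀ {S P a b} → Reach G P a b → ¬ Reach G S a b → ∃ λ f → f ∈ P × ¬ Reach G S (src f) (tgt f)
  crossing here ¬r = contradiction here ¬r
  crossing {S} (step f f∈P J r) ¬r with reach? S (src f) (tgt f)
  ... | no ¬rf = f , f∈P , ¬rf
  ... | yes rf with J
  ...   | inj₁ (refl , refl) = crossing r λ r' → ¬r (Reach-trans rf r')
  ...   | inj₂ (refl , refl) = crossing r λ r' → ¬r (Reach-trans (Reach-sym rf) r')

  abstract
    -- `f` is an edge of the path in `T'` between the ends of `e` that crosses between the
    -- components of `T - e`. It lies on the cycle that `e` closes in `T'` and in the cut that `e`
    -- leaves in `T`, so both swaps give trees.
    exchange : ∀ {T T' e} → IsSpanningTree G T → IsSpanningTree G T' → e ∈ T → e ∉ T' →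
      ∃ λ f → f ∈ T' × f ∉ T × IsSpanningTree G (swap T e f) × IsSpanningTree G (swap T' f e)
    exchange {T} {T'} {e} st@(_ , bridge) st'@(conn' , bridge') e∈T e∉T' with minimalPath T' (conn' (src e) (tgt e))
    ... | P , P⊆T' , pathP , minimal with crossing pathP (bridge e e∈T)
    ...   | f , f∈P , ¬rf = f , f∈T' , f∉T , swap-isSpanningTree e f st e∈T ¬rf , swap-isSpanningTree f e st' f∈T' ¬re
      where
      f∈T' : f ∈ T'
      f∈T' = P⊆T' f∈P
      f∉T : f ∉ T
      f∉T f∈T with f ≟ e
      ... | yes refl = e∉T' f∈T'
      ... | no f≢e   = ¬rf (Reach-edge f (x∈p∧x≢y⇒x∈p-y f∈T f≢e))
      -- A walk between the ends of `e` in `T' - f` would combine with the two pieces of `P` around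
      -- `f` to a detour around the bridge `f` of `T'`.
      ¬re : ¬ Reach G (T' - f) (src e) (tgt e)
      ¬re re with Reach-split f pathP
      ... | inj₁ r = minimal f∈P r
      ... | inj₂ t = bridge' f f∈T' (Through-close (Through-mono P-f⊆ t) re)
        where
        P-f⊆ : P - f ⊆ T' - f
        P-f⊆ x∈ = x∈p∧x≢y⇒x∈p-y (P⊆T' (x∈p-y⇒x∈p P f x∈)) (x∈p-y⇒x≢y P f x∈)

-- Weights

-- The recursion inside weight never looks at the instance, so weight G on a nonempty list of edges unfolds to weight (dropEdge G).
dropEdge : ∀ {n k} → Instance n (suc k) → Instance n k
dropEdge G = record
  { endpoints = endpoints ∘ suc ; trivial = trivial ∘ suc ; L = L ∘ suc ; U = U ∘ suc
  ; trivial-LU = trivial-LU ∘ suc ; open-LU = open-LU ∘ suc }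
  where open Instance G

weight-remove : ∀ {n m} (G : Instance n m) x {T e} → e ∈ T → weight G x (T - e) + x e ≡ weight G x T
weight-remove G x {true ∷ T} {zero} here = trans (cong (λ S → 0ℚ + weight (dropEdge G) (x ∘ suc) S + x zero) (p─⊥≡p T))
  (solve 2 (λ w y → con 0ℚ :+ w :+ y := y :+ w) refl (weight (dropEdge G) (x ∘ suc) T) (x zero))
  where open +-*-Solver
weight-remove G x {b ∷ T} {suc e} (there e∈T) = trans
  (+-assoc (if b then x zero else 0ℚ) (weight (dropEdge G) (x ∘ suc) (T - e)) (x (suc e)))
  (cong ((if b then x zero else 0ℚ) +_) (weight-remove (dropEdge G) (x ∘ suc) e∈T))

weight-insert : ∀ {n m} (G : Instance n m) x {T e} → e ∉ T → weight G x (T ∪ ⁅ e ⁆) ≡ weight G x T + x e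
weight-insert G x {true ∷ T}  {zero} e∉T = contradiction here e∉T
weight-insert G x {false ∷ T} {zero} e∉T = trans (cong (λ S → x zero + weight (dropEdge G) (x ∘ suc) S) (∪-identityʳ T))
  (solve 2 (λ w y → y :+ w := con 0ℚ :+ w :+ y) refl (weight (dropEdge G) (x ∘ suc) T) (x zero))
  where open +-*-Solver
weight-insert G x {true ∷ T}  {suc e} e∉T = trans (cong (x zero +_) (weight-insert (dropEdge G) (x ∘ suc) (e∉T ∘ there)))
  (sym (+-assoc (x zero) (weight (dropEdge G) (x ∘ suc) T) (x (suc e))))
weight-insert G x {false ∷ T} {suc e} e∉T = trans (cong (0ℚ +_) (weight-insert (dropEdge G) (x ∘ suc) (e∉T ∘ there)))
  (sym (+-assoc 0ℚ (weight (dropEdge G) (x ∘ suc) T) (x (suc e))))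

weight-swap : ∀ {n m} (G : Instance n m) x {T e f} → e ∈ T → f ∉ T → weight G x (swap T e f) + x e ≡ weight G x T + x f
weight-swap G x {T} {e} {f} e∈T f∉T = begin
  weight G x (swap T e f) + x e        ≡⟨ cong (_+ x e) (weight-insert G x (f∉T ∘ x∈p-y⇒x∈p T e)) ⟩
  weight G x (T - e) + x f + x e       ≡⟨ solve 3 (λ a b c → a :+ b :+ c := a :+ c :+ b) refl (weight G x (T - e)) (x f) (x e) ⟩
  weight G x (T - e) + x e + x f       ≡⟨ cong (_+ x f) (weight-remove G x e∈T) ⟩
  weight G x T + x f                   ∎
  where
  open +-*-Solver
  open ≡-Reasoning

-- Uncertainty intervals

<⇒≱ : ∀ {p q} → p < q → ¬ q ≤ p
<⇒≱ p<q q≤p = <-irrefl refl (<-≤-trans p<q q≤p)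

-- A query replaces an `interval` by a `point`, so a partially revealed instance is an instance
-- again and every witness argument applies to it.
data Interval : Set where
  point    : ℚ → Interval
  interval : (l u : ℚ) → l < u → Interval

data IsOpen : Interval → Set where
  isOpen : ∀ {l u l<u} → IsOpen (interval l u l<u)

isOpen? : Decidable IsOpen
isOpen? (point _)        = no λ ()
isOpen? (interval _ _ _) = yes isOpen

lo hi : Interval → ℚ
lo (point v)        = v
lo (interval l _ _) = l
hi (point v)        = v
hi (interval _ u _) = u

infix 4 _∈ᴵ_ _≼ᴸ_ _≼ᵁ_

_∈ᴵ_ : ℚ → Interval → Set
x ∈ᴵ point v        = x ≡ v
x ∈ᴵ interval l u _ = l < x × x < u

-- The orders of lo + ε and of hi - ε for infinitesimal ε, where ε is only applied to open intervals.
_≼ᴸ_ _≼ᵁ_ : Interval → Interval → Set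
i ≼ᴸ j = lo i ≤ lo j × (IsOpen i → ¬ IsOpen j → lo i < lo j)
i ≼ᵁ j = hi i ≤ hi j × (¬ IsOpen i → IsOpen j → hi i < hi j)

_≼ᴸ?_ : ∀ i j → Dec (i ≼ᴸ j)
i ≼ᴸ? j = (lo i ≤? lo j) ×-dec (isOpen? i →-dec (¬? (isOpen? j) →-dec (lo i <? lo j)))

_≼ᵁ?_ : ∀ i j → Dec (i ≼ᵁ j)
i ≼ᵁ? j = (hi i ≤? hi j) ×-dec (¬? (isOpen? i) →-dec (isOpen? j →-dec (hi i <? hi j)))

lo<hi⇒IsOpen : ∀ i → lo i < hi i → IsOpen i
lo<hi⇒IsOpen (point _)        v<v = contradiction v<v (<-irrefl refl)
lo<hi⇒IsOpen (interval _ _ _) _   = isOpen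

hi≤lo : ∀ i → ¬ IsOpen i → hi i ≤ lo i
hi≤lo i ¬open = ≮⇒≥ (¬open ∘ lo<hi⇒IsOpen i)

lo≤∈ : ∀ i {x} → x ∈ᴵ i → lo i ≤ x
lo≤∈ (point _)        refl      = ≤-refl
lo≤∈ (interval _ _ _) (l<x , _) = <⇒≤ l<x

∈≤hi : ∀ i {x} → x ∈ᴵ i → x ≤ hi i
∈≤hi (point _)        refl      = ≤-refl
∈≤hi (interval _ _ _) (_ , x<u) = <⇒≤ x<u

lo<hi : ∀ {i} → IsOpen i → lo i < hi i
lo<hi (isOpen {l<u = l<u}) = l<u

lo<∧<hi⇒∈ : ∀ {i x} → IsOpen i → lo i < x → x < hi i → x ∈ᴵ i
lo<∧<hi⇒∈ isOpen = _,_

-- The purpose of the strict clause of `_≼ᴸ_`: an open `i` has room below every value that `j` can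
-- take, even if `j` is a point.
≼ᴸ⇒lo<∈ : ∀ {i j x} → IsOpen i → i ≼ᴸ j → x ∈ᴵ j → lo i < x
≼ᴸ⇒lo<∈ {j = point _}        open-i (_ , strict) refl      = strict open-i λ ()
≼ᴸ⇒lo<∈ {j = interval _ _ _} open-i (le , _)     (l<x , _) = ≤-<-trans le l<x

≼ᵁ⇒∈<hi : ∀ {i j x} → IsOpen j → i ≼ᵁ j → x ∈ᴵ i → x < hi j
≼ᵁ⇒∈<hi {point _}        open-j (_ , strict) refl      = strict (λ ()) open-j
≼ᵁ⇒∈<hi {interval _ _ _} open-j (le , _)     (_ , x<u) = <-≤-trans x<u le

dense-⊓ : ∀ {l u h} → l < u → l < h → ∃ λ y → l < y × y < u × y < h
dense-⊓ {l} {u} {h} l<u l<h with ≤-total u h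
... | inj₁ u≤h = let (y , l<y , y<u) = <-dense l<u in y , l<y , y<u , <-≤-trans y<u u≤h
... | inj₂ h≤u = let (y , l<y , y<h) = <-dense l<h in y , l<y , <-≤-trans y<h h≤u , y<h

dense-⊔ : ∀ {l u h} → l < u → h < u → ∃ λ y → l < y × h < y × y < u
dense-⊔ {l} {u} {h} l<u h<u with ≤-total l h
... | inj₁ l≤h = let (y , h<y , y<u) = <-dense h<u in y , ≤-<-trans l≤h h<y , h<y , y<u
... | inj₂ h≤l = let (y , l<y , y<u) = <-dense l<u in y , l<y , ≤-<-trans h≤l l<y , y<u

module _ {A : Set} (f : A → ℚ) {P : A → Set} (P? : Decidable P) {l u : ℚ} (l<u : l < u) where

  dense-below : (∀ {a} → P a → l < f a) → (xs : List A) → ∃ λ v → l < v × v < u × (∀ {a} → a List.∈ xs → P a → v < f a)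
  dense-below l<f [] = let (v , l<v , v<u) = <-dense l<u in v , l<v , v<u , λ ()
  dense-below l<f (x ∷ xs) with dense-below l<f xs | P? x
  ... | v , l<v , v<u , v<f | no ¬px = v , l<v , v<u , λ { (here refl) px → contradiction px ¬px ; (there a∈) → v<f a∈ }
  ... | v , l<v , v<u , v<f | yes px =
    let (y , l<y , y<v , y<fx) = dense-⊓ l<v (l<f px) in
    y , l<y , <-trans y<v v<u , λ { (here refl) _ → y<fx ; (there a∈) pa → <-trans y<v (v<f a∈ pa) }

  dense-above : (∀ {a} → P a → f a < u) → (xs : List A) → ∃ λ v → l < v × v < u × (∀ {a} → a List.∈ xs → P a → f a < v)
  dense-above f<u [] = let (v , l<v , v<u) = <-dense l<u in v , l<v , v<u , λ ()
  dense-above f<u (x ∷ xs) with dense-above f<u xs | P? x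
  ... | v , l<v , v<u , f<v | no ¬px = v , l<v , v<u , λ { (here refl) px → contradiction px ¬px ; (there a∈) → f<v a∈ }
  ... | v , l<v , v<u , f<v | yes px =
    let (y , v<y , fx<y , y<u) = dense-⊔ v<u (f<u px) in
    y , <-trans l<v v<y , y<u , λ { (here refl) _ → fx<y ; (there a∈) pa → <-trans (f<v a∈ pa) v<y }

_[_≔_] : ∀ {m} → (Fin m → ℚ) → Fin m → ℚ → Fin m → ℚ
(w [ e ≔ v ]) g with g ≟ e
... | yes _ = v
... | no _  = w g

[≔]-same : ∀ {m} (w : Fin m → ℚ) e v → (w [ e ≔ v ]) e ≡ v
[≔]-same w e v with e ≟ e
... | yes _  = refl
... | no e≢e = contradiction refl e≢e

[≔]-other : ∀ {m} (w : Fin m → ℚ) {e} v {g} → g ≢ e → (w [ e ≔ v ]) g ≡ w g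
[≔]-other w {e} v {g} g≢e with g ≟ e
... | yes g≡e = contradiction g≡e g≢e
... | no _    = refl

[≔]-< : ∀ {m} (x : Fin m → ℚ) {e v g} → g ≢ e → v < x g → (x [ e ≔ v ]) e < (x [ e ≔ v ]) g
[≔]-< x {e} {v} {g} g≢e v<x = subst (_< (x [ e ≔ v ]) g) (sym ([≔]-same x e v)) (subst (v <_) (sym ([≔]-other x v g≢e)) v<x)

[≔]-> : ∀ {m} (x : Fin m → ℚ) {e v g} → g ≢ e → x g < v → (x [ e ≔ v ]) g < (x [ e ≔ v ]) e
[≔]-> x {e} {v} {g} g≢e x<v = subst ((x [ e ≔ v ]) g <_) (sym ([≔]-same x e v)) (subst (_< v) (sym ([≔]-other x v g≢e)) x<v)

ValidIn : ∀ {m} → (Fin m → Interval) → (Fin m → ℚ) → Set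
ValidIn K x = ∀ e → x e ∈ᴵ K e

Opens : ∀ {m} → (Fin m → Interval) → Subset m
Opens K = ⟦ isOpen? ∘ K ⟧

reveal : ∀ {m} → (Fin m → Interval) → Subset m → (Fin m → ℚ) → Fin m → Interval
reveal K S v e with e ∈? S
... | yes _ = point (v e)
... | no _  = K e

reveal-∈ : ∀ {m} (K : Fin m → Interval) {S} (v : Fin m → ℚ) {e} → e ∈ S → reveal K S v e ≡ point (v e)
reveal-∈ K {S} v {e} e∈S with e ∈? S
... | yes _  = refl
... | no e∉S = contradiction e∈S e∉S

reveal-∉ : ∀ {m} (K : Fin m → Interval) {S} (v : Fin m → ℚ) {e} → e ∉ S → reveal K S v e ≡ K e
reveal-∉ K {S} v {e} e∉S with e ∈? S
... | yes e∈S = contradiction e∈S e∉S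
... | no _    = refl

module _ {m} (K : Fin m → Interval) {S : Subset m} {v : Fin m → ℚ} where

  reveal-valid : ∀ {w} → (∀ {e} → e ∈ S → v e ≡ w e) → ValidIn K w → ValidIn (reveal K S v) w
  reveal-valid v≡w valid e with e ∈? S
  ... | yes e∈S = sym (v≡w e∈S)
  ... | no _    = valid e

  reveal-⊆ : (∀ {e} → e ∈ S → v e ∈ᴵ K e) → ∀ {e x} → x ∈ᴵ reveal K S v e → x ∈ᴵ K e
  reveal-⊆ v∈K {e} x∈ with e ∈? S
  ... | yes e∈S = subst (_∈ᴵ K e) (sym x∈) (v∈K e∈S)
  ... | no _    = x∈

  reveal-open : ∀ {e} → IsOpen (reveal K S v e) → IsOpen (K e) × e ∉ S
  reveal-open {e} o with e ∈? S
  reveal-open () | yes _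
  ... | no e∉S = o , e∉S

-- The query problem for an arbitrary basis system

module Bases {m} (Base : Subset m → Set) (base? : Decidable Base)
  (exch : ∀ {T T' e} → Base T → Base T' → e ∈ T → e ∉ T' →
     ∃ λ f → f ∈ T' × f ∉ T × Base (swap T e f) × Base (swap T' f e)) where

  -- Local optimality, upgraded to minimum weight by `optimal⇒minimal`. For fixed `f ∉ T`, the
  -- `e ∈ T` with `Base (swap T e f)` are the tree edges on the cycle closed by `f`; for fixed
  -- `e ∈ T`, the `f ∉ T` are the other edges of the cut left by `e`.
  Optimal : (Fin m → ℚ) → Subset m → Set
  Optimal x T = Base T × (∀ {e f} → e ∈ T → f ∉ T → Base (swap T e f) → x e ≤ x f)

  FeasibleIn : (Fin m → Interval) → (Fin m → ℚ) → Subset m → Set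
  FeasibleIn K w Q = ∃ λ T → ∀ x → (∀ e → e ∈ Q → x e ≡ w e) → (∀ e → e ∉ Q → x e ∈ᴵ K e) → Optimal x T

  LowerOptimal UpperOptimal : (Fin m → Interval) → Subset m → Set
  LowerOptimal K T = ∀ e f → e ∈ T → f ∉ T → Base (swap T e f) → K e ≼ᴸ K f
  UpperOptimal K T = ∀ e f → e ∈ T → f ∉ T → Base (swap T e f) → K e ≼ᵁ K f

  module _ {x T'} (opt : Optimal x T') {T} (bT : Base T) where

    -- If `T'` omitted `e`, symmetric exchange would let the strictly cheaper `e` replace an edge of
    -- its cut in `T'`.
    cut-minimum∈ : ∀ {e} → e ∈ T → (∀ {g} → g ∉ T → Base (swap T e g) → x e < x g) → e ∈ T'
    cut-minimum∈ {e} e∈T least with e ∈? T'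
    ... | yes e∈T' = e∈T'
    ... | no e∉T'  = let (f , f∈T' , f∉T , b , b') = exch bT (proj₁ opt) e∈T e∉T' in
      contradiction (proj₂ opt f∈T' e∉T' b') (<⇒≱ (least f∉T b))

    cycle-maximum∉ : ∀ {f} → f ∉ T → (∀ {c} → c ∈ T → Base (swap T c f) → x c < x f) → f ∉ T'
    cycle-maximum∉ f∉T greatest f∈T' = let (c , c∈T , c∉T' , b' , b) = exch (proj₁ opt) bT f∈T' f∉T in
      contradiction (proj₂ opt f∈T' c∉T' b') (<⇒≱ (greatest c∈T b))

  -- The cycle that `e` closes in the swapped tree is the cycle that `f` closes in `T`, so it can be
  -- compared edge by edge in `T`.
  swap-swapˡ : ∀ {T : Subset m} {e f c} → e ∈ T → f ∉ T → c ≢ e → c ≢ f → swap (swap T e f) c e ≡ swap T c f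
  swap-swapˡ {T} {e} {f} {c} e∈T f∉T c≢e c≢f = ⊆-antisym to from
    where
    to : swap (swap T e f) c e ⊆ swap T c f
    to x∈ with ∈swap⁻ {T = swap T e f} x∈
    ... | inj₂ refl        = ∈swap⁺ e∈T (c≢e ∘ sym)
    ... | inj₁ (x∈' , x≢c) = [ (λ (x∈T , _) → ∈swap⁺ x∈T x≢c) , (λ { refl → f∈swap {T = T} }) ]′ (∈swap⁻ {T = T} x∈')
    from : swap T c f ⊆ swap (swap T e f) c e
    from {x} x∈ with ∈swap⁻ {T = T} x∈ | x ≟ e
    ... | _                | yes refl = f∈swap {T = swap T e f}
    ... | inj₁ (x∈T , x≢c) | no x≢e   = ∈swap⁺ (∈swap⁺ x∈T x≢e) x≢c
    ... | inj₂ refl        | no x≢e   = ∈swap⁺ (f∈swap {T = T}) (c≢f ∘ sym)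

  -- Dually, the cut left by `f` in the swapped tree is the cut left by `e` in `T`.
  swap-swapʳ : ∀ {T : Subset m} {e f g} → f ∉ T → swap (swap T e f) f g ≡ swap T e g
  swap-swapʳ {T} {e} {f} {g} f∉T = ⊆-antisym to from
    where
    to : swap (swap T e f) f g ⊆ swap T e g
    to x∈ with ∈swap⁻ {T = swap T e f} x∈
    ... | inj₂ refl        = f∈swap {T = T}
    ... | inj₁ (x∈' , x≢f) = [ (λ (x∈T , x≢e) → ∈swap⁺ x∈T x≢e) , (λ x≡f → contradiction x≡f x≢f) ]′ (∈swap⁻ {T = T} x∈')
    from : swap T e g ⊆ swap (swap T e f) f g
    from x∈ with ∈swap⁻ {T = T} x∈
    ... | inj₂ refl        = f∈swap {T = swap T e f}
    ... | inj₁ (x∈T , x≢e) = ∈swap⁺ (∈swap⁺ x∈T x≢e) (∈∧∉⇒≢ x∈T f∉T)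

  -- A query set may contain edges whose value is known already. Such a member gives no information
  -- and must not count as hitting a witness set.
  InPlay : (Fin m → Interval) → Subset m → Fin m → Set
  InPlay K Q e = e ∈ Q × IsOpen (K e)

  module _ {K : Fin m → Interval} {w : Fin m → ℚ} (valid : ValidIn K w) {Q : Subset m} where

    -- The value of an unqueried edge is moved towards one end of its interval; an edge with a known value is there already.
    decrease : ∀ {e h} → ¬ InPlay K Q e → lo (K e) < h → ∃ λ y → y ∈ᴵ K e × y < h × (e ∈ Q → y ≡ w e)
    decrease {e} {h} ¬play lo<h with isOpen? (K e)
    ... | no ¬open = w e , valid e , ≤-<-trans (∈≤hi (K e) (valid e)) (≤-<-trans (hi≤lo (K e) ¬open) lo<h) , λ _ → refl
    ... | yes o = let (y , lo<y , y<hi , y<h) = dense-⊓ (lo<hi o) lo<h in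
      y , lo<∧<hi⇒∈ o lo<y y<hi , y<h , λ e∈Q → contradiction (e∈Q , o) ¬play

    increase : ∀ {e h} → ¬ InPlay K Q e → h < hi (K e) → ∃ λ y → y ∈ᴵ K e × h < y × (e ∈ Q → y ≡ w e)
    increase {e} {h} ¬play h<hi with isOpen? (K e)
    ... | no ¬open = w e , valid e , <-≤-trans h<hi (≤-trans (hi≤lo (K e) ¬open) (lo≤∈ (K e) (valid e))) , λ _ → refl
    ... | yes o = let (y , lo<y , h<y , y<hi) = dense-⊔ (lo<hi o) h<hi in
      y , lo<∧<hi⇒∈ o lo<y y<hi , h<y , λ e∈Q → contradiction (e∈Q , o) ¬play

    Consistent : (Fin m → ℚ) → Set
    Consistent x = ∀ e → x e ∈ᴵ K e × (e ∈ Q → x e ≡ w e)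

    w-consistent : Consistent w
    w-consistent e = valid e , λ _ → refl

    [≔]-consistent : ∀ {x e v} → Consistent x → v ∈ᴵ K e → (e ∈ Q → v ≡ w e) → Consistent (x [ e ≔ v ])
    [≔]-consistent {x} {e} {v} cons v∈ v≡ g with g ≟ e
    ... | yes refl = v∈ , v≡
    ... | no _     = cons g

    module _ (feasible : FeasibleIn K w Q) where

      optimal : ∀ {x} → Consistent x → Optimal x (proj₁ feasible)
      optimal {x} cons = proj₂ feasible x (λ e → proj₂ (cons e)) (λ e _ → proj₁ (cons e))

      -- If neither is queried then e, being the largest edge on the cycle closed by f when it is near its upper limit,
      -- is left out of some optimum, but when it is near its lower limit it is the least edge of its cut.
      treeEdge-witness : ∀ {T e f} → Base T → e ∈ T → f ∉ T → Base (swap T e f) → IsOpen (K e) →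
        (∀ {g} → g ∉ T → Base (swap T e g) → K e ≼ᴸ K g) → (∀ {c} → c ∈ T → Base (swap T c f) → K c ≼ᵁ K e) →
        lo (K f) < hi (K e) → e ∈ Q ⊎ InPlay K Q f
      treeEdge-witness {T} {e} {f} bT e∈T f∉T bTef open-e least greatest lof<hie with e ∈? Q | (f ∈? Q) ×-dec isOpen? (K f)
      ... | yes e∈Q | _        = inj₁ e∈Q
      ... | no _    | yes play = inj₂ play
      ... | no e∉Q  | no ¬play = contradiction in-optimum not-in-optimum
        where
        e≢f : e ≢ f
        e≢f = ∈∧∉⇒≢ e∈T f∉T
        in-optimum : e ∈ proj₁ feasible
        in-optimum with dense-below w (λ g → ¬? (g ∈? T) ×-dec base? (swap T e g)) (lo<hi open-e)
                          (λ (g∉T , b) → ≼ᴸ⇒lo<∈ open-e (least g∉T b) (valid _)) (allFin m)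
        ... | v , lo<v , v<hi , v<w = cut-minimum∈
          (optimal ([≔]-consistent w-consistent (lo<∧<hi⇒∈ open-e lo<v v<hi) λ e∈Q → contradiction e∈Q e∉Q)) bT e∈T
          λ {g} g∉T b → [≔]-< w (∈∧∉⇒≢ e∈T g∉T ∘ sym) (v<w (∈-allFin g) (g∉T , b))
        not-in-optimum : e ∉ proj₁ feasible
        not-in-optimum with decrease ¬play lof<hie
        ... | y , y∈ , y<hi , y≡ with dense-above (w [ f ≔ y ]) (λ c → (c ≟ f) ⊎-dec ((c ∈? T) ×-dec base? (swap T c f)))
                (lo<hi open-e) (λ { (inj₁ refl) → subst (_< hi (K e)) (sym ([≔]-same w f y)) y<hi
                                  ; (inj₂ (c∈T , b)) → subst (_< hi (K e)) (sym ([≔]-other w y (∈∧∉⇒≢ c∈T f∉T)))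
                                                         (≼ᵁ⇒∈<hi open-e (greatest c∈T b) (valid _)) }) (allFin m)
        ...   | v , lo<v , v<hi , w<v = cycle-maximum∉
          (optimal ([≔]-consistent ([≔]-consistent w-consistent y∈ y≡) (lo<∧<hi⇒∈ open-e lo<v v<hi) λ e∈Q → contradiction e∈Q e∉Q))
          bTef (e∉swap {T = T} e≢f) λ {c} c∈ b → [≔]-> (w [ f ≔ y ]) (∈∧∉⇒≢ {T = swap T e f} c∈ (e∉swap {T = T} e≢f))
            (w<v (∈-allFin c) (onCycle (∈swap⁻ {T = T} c∈) b))
          where
          onCycle : ∀ {c} → (c ∈ T × c ≢ e) ⊎ c ≡ f → Base (swap (swap T e f) c e) → c ≡ f ⊎ (c ∈ T × Base (swap T c f))
          onCycle (inj₂ c≡f)         b = inj₁ c≡f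
          onCycle (inj₁ (c∈T , c≢e)) b = inj₂ (c∈T , subst Base (swap-swapˡ e∈T f∉T c≢e (∈∧∉⇒≢ c∈T f∉T)) b)

      -- Dual to `treeEdge-witness`. Near its upper limit, `f` is the strict maximum of its cycle in
      -- `T`; near its lower limit and with `e` raised above it, `f` is the strict minimum of its
      -- cut in `swap T e f`. No single tree is optimal in both cases.
      nonTreeEdge-witness : ∀ {T e f} → Base T → e ∈ T → f ∉ T → Base (swap T e f) → IsOpen (K f) →
        (∀ {c} → c ∈ T → Base (swap T c f) → K c ≼ᵁ K f) → (∀ {g} → g ∉ T → Base (swap T e g) → K f ≼ᴸ K g) →
        lo (K f) < hi (K e) → f ∈ Q ⊎ InPlay K Q e
      nonTreeEdge-witness {T} {e} {f} bT e∈T f∉T bTef open-f greatest least lof<hie with f ∈? Q | (e ∈? Q) ×-dec isOpen? (K e)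
      ... | yes f∈Q | _        = inj₁ f∈Q
      ... | no _    | yes play = inj₂ play
      ... | no f∉Q  | no ¬play = contradiction in-optimum not-in-optimum
        where
        not-in-optimum : f ∉ proj₁ feasible
        not-in-optimum with dense-above w (λ c → (c ∈? T) ×-dec base? (swap T c f)) (lo<hi open-f)
                              (λ (c∈T , b) → ≼ᵁ⇒∈<hi open-f (greatest c∈T b) (valid _)) (allFin m)
        ... | v , lo<v , v<hi , w<v = cycle-maximum∉
          (optimal ([≔]-consistent w-consistent (lo<∧<hi⇒∈ open-f lo<v v<hi) λ f∈Q → contradiction f∈Q f∉Q)) bT f∉T
          λ {c} c∈T b → [≔]-> w (∈∧∉⇒≢ c∈T f∉T) (w<v (∈-allFin c) (c∈T , b))
        in-optimum : f ∈ proj₁ feasible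
        -- The value of `e` is fixed first, because the value of `f` must lie below it and below the
        -- rest of the cut.
        in-optimum with increase ¬play lof<hie
        ... | y , y∈ , lo<y , y≡ with dense-below (w [ e ≔ y ]) (λ g → (g ≟ e) ⊎-dec (¬? (g ∈? T) ×-dec base? (swap T e g)))
                (lo<hi open-f) (λ { (inj₁ refl) → subst (lo (K f) <_) (sym ([≔]-same w e y)) lo<y
                                  ; (inj₂ (g∉T , b)) → subst (lo (K f) <_) (sym ([≔]-other w y (∈∧∉⇒≢ e∈T g∉T ∘ sym)))
                                                         (≼ᴸ⇒lo<∈ open-f (least g∉T b) (valid _)) }) (allFin m)
        ...   | v , lo<v , v<hi , v<w = cut-minimum∈
          (optimal ([≔]-consistent ([≔]-consistent w-consistent y∈ y≡) (lo<∧<hi⇒∈ open-f lo<v v<hi) λ f∈Q → contradiction f∈Q f∉Q))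
          bTef (f∈swap {T = T}) λ {g} g∉ b → [≔]-< (w [ e ≔ y ]) (∈∧∉⇒≢ {T = swap T e f} (f∈swap {T = T}) g∉ ∘ sym)
            (v<w (∈-allFin g) (inCut g∉ b))
          where
          inCut : ∀ {g} → g ∉ swap T e f → Base (swap (swap T e f) f g) → g ≡ e ⊎ (g ∉ T × Base (swap T e g))
          inCut {g} g∉ b with g ≟ e
          ... | yes g≡e = inj₁ g≡e
          ... | no g≢e  = inj₂ ((λ g∈T → g∉ (∈swap⁺ g∈T g≢e)) , subst Base (swap-swapʳ f∉T) b)

module WeightedBases {m} (Base : Subset m → Set) (base? : Decidable Base)
  (exch : ∀ {T T' e} → Base T → Base T' → e ∈ T → e ∉ T' →
     ∃ λ f → f ∈ T' × f ∉ T × Base (swap T e f) × Base (swap T' f e))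
  (wt : (Fin m → ℚ) → Subset m → ℚ)
  (wt-swap : ∀ x {T e f} → e ∈ T → f ∉ T → wt x (swap T e f) + x e ≡ wt x T + x f) where

  open Bases Base base? exch public

  module _ (x : Fin m → ℚ) {T : Subset m} {e f : Fin m} (e∈T : e ∈ T) (f∉T : f ∉ T) where

    wt-swap-≤⁻ : wt x T ≤ wt x (swap T e f) → x e ≤ x f
    wt-swap-≤⁻ le = ≮⇒≥ λ xf<xe → <⇒≱ (+-monoʳ-< (wt x T) xf<xe)
      (≤-trans (+-monoˡ-≤ (x e) le) (≤-reflexive (wt-swap x e∈T f∉T)))

    wt-swap-≤⁺ : x f ≤ x e → wt x (swap T e f) ≤ wt x T
    wt-swap-≤⁺ le = ≮⇒≥ λ lt → <⇒≱ (+-monoˡ-< (x e) lt)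
      (≤-trans (≤-reflexive (wt-swap x e∈T f∉T)) (+-monoʳ-≤ (wt x T) le))

  Minimal : (Fin m → ℚ) → Subset m → Set
  Minimal x T = Base T × (∀ T' → Base T' → wt x T ≤ wt x T')

  minimal⇒optimal : ∀ {x T} → Minimal x T → Optimal x T
  minimal⇒optimal {x} (bT , min) = bT , λ e∈T f∉T b → wt-swap-≤⁻ x e∈T f∉T (min _ b)

  -- Any competitor `T'` is moved towards `T` one exchange at a time. Local optimality of `T` makes
  -- each exchange no more expensive, and `T ─ T'` shrinks.
  optimal⇒minimal : ∀ {x T} → Optimal x T → Minimal x T
  optimal⇒minimal {x} {T} (bT , opt) = bT , λ T' → go _ T' ℕ.≤-refl
    where
    go : ∀ k T' → ∣ T ─ T' ∣ ℕ.≤ k → Base T' → wt x T ≤ wt x T'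
    go k T' ∣T─T'∣≤k bT' with nonempty? (T ─ T')
    go k T' ∣T─T'∣≤k bT' | no T─T'∅ = ≤-reflexive (cong (wt x) (⊆-antisym T⊆T' T'⊆T))
      where
      T⊆T' : T ⊆ T'
      T⊆T' {e} e∈T with e ∈? T'
      ... | yes e∈T' = e∈T'
      ... | no e∉T'  = contradiction (e , x∈p∧x∉q⇒x∈p─q e∈T e∉T') T─T'∅
      -- An edge of `T'` outside `T` would be exchanged for an edge of `T` outside `T'`, and there
      -- is none.
      T'⊆T : T' ⊆ T
      T'⊆T {f} f∈T' with f ∈? T
      ... | yes f∈T = f∈T
      ... | no f∉T  = let (c , c∈T , c∉T' , _) = exch bT' bT f∈T' f∉T in contradiction (T⊆T' c∈T) c∉T'
    go zero T' ∣T─T'∣≤0 bT' | yes (e , e∈) = contradiction (ℕ.≤-trans (x∈p⇒∣p-x∣<∣p∣ e∈) ∣T─T'∣≤0) ℕ.n≮0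
    go (suc k) T' ∣T─T'∣≤k bT' | yes (e , e∈) with exch bT bT' (p─q⊆p T T' e∈) (x∈p─q⇒x∉q T T' e∈)
    ... | f , f∈T' , f∉T , b , b' = ≤-trans (go k (swap T' f e) (ℕ.≤-pred (ℕ.≤-trans (p⊂q⇒∣p∣<∣q∣ closer) ∣T─T'∣≤k)) b')
                                    (wt-swap-≤⁺ x f∈T' e∉T' (opt e∈T f∉T b))
      where
      e∈T : e ∈ T
      e∈T = p─q⊆p T T' e∈
      e∉T' : e ∉ T'
      e∉T' = x∈p─q⇒x∉q T T' e∈
      closer : T ─ swap T' f e ⊂ T ─ T'
      closer = (λ {g} g∈ → x∈p∧x∉q⇒x∈p─q (p─q⊆p T _ g∈) λ g∈T' →
                  x∈p─q⇒x∉q T _ g∈ (∈swap⁺ g∈T' (∈∧∉⇒≢ (p─q⊆p T _ g∈) f∉T)))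
             , e , e∈ , λ e∈' → x∈p─q⇒x∉q T _ e∈' (f∈swap {T = T'})

  minimal : ∀ x {P : Subset m → Set} → Decidable P → ∃ P → ∃ λ T → P T × (∀ T' → P T' → wt x T ≤ wt x T')
  minimal x P? (S , pS) with minimiser _≤_ ≤-total ≤-trans (wt x) P? (subsets m)
  ... | inj₁ (T , pT , min) = T , pT , λ T' → min (∈-subsets T')
  ... | inj₂ none           = contradiction pS (none (∈-subsets S))

  -- Minimise the total lower limit and, among the minimisers, the number of open intervals.
  lowerOptimal : ∀ K → ∃ Base → ∃ λ T → Base T × LowerOptimal K T
  lowerOptimal K base = T , bT , λ e f e∈T f∉T b →
    let lo-e≤lo-f = wt-swap-≤⁻ (lo ∘ K) e∈T f∉T (≤-trans T≤T₁ (min₁ _ b)) in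
    lo-e≤lo-f , λ open-e ¬open-f → ≰⇒> λ lo-f≤lo-e → <⇒≱ 0<1
      (subst₂ _≤_ (open#-open open-e) (open#-trivial ¬open-f)
        (wt-swap-≤⁻ open# e∈T f∉T (minT _ (b , ≤-trans (wt-swap-≤⁺ (lo ∘ K) e∈T f∉T lo-f≤lo-e) T≤T₁))))
    where
    open# : Fin m → ℚ
    open# e with isOpen? (K e)
    ... | yes _ = 1ℚ
    ... | no _  = 0ℚ
    open#-open : ∀ {e} → IsOpen (K e) → open# e ≡ 1ℚ
    open#-open {e} o with isOpen? (K e)
    ... | yes _ = refl
    ... | no ¬o = contradiction o ¬o
    open#-trivial : ∀ {e} → ¬ IsOpen (K e) → open# e ≡ 0ℚ
    open#-trivial {e} ¬o with isOpen? (K e)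
    ... | yes o = contradiction o ¬o
    ... | no _  = refl
    0<1 : 0ℚ < 1ℚ
    0<1 = from-yes (0ℚ <? 1ℚ)
    first = minimal (lo ∘ K) base? base
    T₁ = proj₁ first
    min₁ = proj₂ (proj₂ first)
    second = minimal open# (λ S → base? S ×-dec (wt (lo ∘ K) S ≤? wt (lo ∘ K) T₁)) (T₁ , proj₁ (proj₂ first) , ≤-refl)
    T = proj₁ second
    bT = proj₁ (proj₁ (proj₂ second))
    T≤T₁ = proj₂ (proj₁ (proj₂ second))
    minT = proj₂ (proj₂ second)

  -- Witness pairs in a partially revealed instance

  open-above : ∀ {K T} → LowerOptimal K T → ∀ {e f} → e ∈ T → f ∉ T → Base (swap T e f) → lo (K f) < hi (K e) → IsOpen (K e)
  open-above {K} lower {e} {f} e∈T f∉T b lof<hie = lo<hi⇒IsOpen (K e) (≤-<-trans (proj₁ (lower e f e∈T f∉T b)) lof<hie)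

  open-below : ∀ {K T} → UpperOptimal K T → ∀ {e f} → e ∈ T → f ∉ T → Base (swap T e f) → lo (K f) < hi (K e) → IsOpen (K f)
  open-below {K} upper {e} {f} e∈T f∉T b lof<hie = lo<hi⇒IsOpen (K f) (<-≤-trans lof<hie (proj₁ (upper e f e∈T f∉T b)))

  -- Maximal `hi` on the cycle is enough for `_≼ᵁ_`: a point `c'` on the cycle has value at most
  -- `lo (K f)`, hence strictly below the maximum.
  highest-on-cycle : ∀ {K T} → LowerOptimal K T → ∀ {e f} → e ∈ T → f ∉ T → Base (swap T e f) → lo (K f) < hi (K e) →
    ∃ λ c → c ∈ T × Base (swap T c f) × hi (K e) ≤ hi (K c) × (∀ {c'} → c' ∈ T → Base (swap T c' f) → K c' ≼ᵁ K c)
  highest-on-cycle {K} {T} lower {e} {f} e∈T f∉T b lof<hie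
    with minimiser (λ x y → y ≤ x) (λ x y → ≤-total y x) (λ y≤x z≤y → ≤-trans z≤y y≤x) (hi ∘ K)
           (λ c → (c ∈? T) ×-dec base? (swap T c f)) (allFin m)
  ... | inj₂ none = contradiction (e∈T , b) (none (∈-allFin e))
  ... | inj₁ (c , (c∈T , bc) , max) = c , c∈T , bc , e≤c , λ {c'} c'∈T b' → max (∈-allFin c') (c'∈T , b') ,
        λ ¬open _ → ≤-<-trans (≤-trans (hi≤lo (K c') ¬open) (proj₁ (lower c' f c'∈T f∉T b'))) (<-≤-trans lof<hie e≤c)
    where
    e≤c : hi (K e) ≤ hi (K c)
    e≤c = max (∈-allFin e) (e∈T , b)

  lowest-in-cut : ∀ {K T} → UpperOptimal K T → ∀ {e f} → e ∈ T → f ∉ T → Base (swap T e f) → lo (K f) < hi (K e) →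
    ∃ λ g → g ∉ T × Base (swap T e g) × lo (K g) ≤ lo (K f) × (∀ {g'} → g' ∉ T → Base (swap T e g') → K g ≼ᴸ K g')
  lowest-in-cut {K} {T} upper {e} {f} e∈T f∉T b lof<hie
    with minimiser _≤_ ≤-total ≤-trans (lo ∘ K) (λ g → ¬? (g ∈? T) ×-dec base? (swap T e g)) (allFin m)
  ... | inj₂ none = contradiction (f∉T , b) (none (∈-allFin f))
  ... | inj₁ (g , (g∉T , bg) , min) = g , g∉T , bg , g≤f , λ {g'} g'∉T b' → min (∈-allFin g') (g'∉T , b') ,
        λ _ ¬open → <-≤-trans (≤-<-trans g≤f lof<hie) (≤-trans (proj₁ (upper e g' e∈T g'∉T b')) (hi≤lo (K g') ¬open))
    where
    g≤f : lo (K g) ≤ lo (K f)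
    g≤f = min (∈-allFin f) (f∉T , b)

  feasible-reveal : ∀ {K w S v Q} → (∀ {e} → e ∈ S → v e ≡ w e) → ValidIn K w → FeasibleIn K w Q → FeasibleIn (reveal K S v) w Q
  feasible-reveal {K} v≡w valid (T , opt) = T , λ x x≡w x∈ → opt x x≡w λ e e∉Q →
    reveal-⊆ K (λ e∈S → subst (_∈ᴵ K _) (sym (v≡w e∈S)) (valid _)) (x∈ e e∉Q)

  feasible-unreveal : ∀ {K w S v Q} → (∀ {e} → e ∈ S → v e ≡ w e) → FeasibleIn (reveal K S v) w Q → FeasibleIn K w (S ∪ Q)
  feasible-unreveal {K} {w} {S} {v} {Q} v≡w (T , opt) = T , λ x x≡w x∈ → opt x (λ e e∈Q → x≡w e (q⊆p∪q S Q e∈Q))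
    λ e e∉Q → revealed x x≡w x∈ e∉Q
    where
    revealed : ∀ x → (∀ e → e ∈ S ∪ Q → x e ≡ w e) → (∀ e → e ∉ S ∪ Q → x e ∈ᴵ K e) → ∀ {e} → e ∉ Q → x e ∈ᴵ reveal K S v e
    revealed x x≡w x∈ {e} e∉Q with e ∈? S
    ... | yes e∈S = trans (x≡w e (p⊆p∪q Q e∈S)) (sym (v≡w e∈S))
    ... | no e∉S  = x∈ e λ e∈ → [ e∉S , e∉Q ]′ (x∈p∪q⁻ S Q e∈)

  Resolved : (Fin m → Interval) → Subset m → Set
  Resolved K T = ∀ {e f} → e ∈ T → f ∉ T → Base (swap T e f) → hi (K e) ≤ lo (K f)

  resolved⇒feasible : ∀ {K w T} → Base T → Resolved K T → FeasibleIn K w ⊥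
  resolved⇒feasible {K} {w} {T} bT resolved = T , λ x _ x∈ → bT , λ {e} {f} e∈T f∉T b →
    ≤-trans (∈≤hi (K e) (x∈ e ∉⊥)) (≤-trans (resolved e∈T f∉T b) (lo≤∈ (K f) (x∈ f ∉⊥)))

-- Adaptive strategies as decision trees

-- An `Algorithm` sees only histories. A decision tree can be built and analysed by recursion over
-- revealed instances, and `next` recovers the answer to a history by descending along the revealed
-- values.
data Strategy (m : ℕ) : Set where
  done  : Strategy m
  query : Fin m → (ℚ → Strategy m) → Strategy m

module _ {m : ℕ} where

  play : Strategy m → (Fin m → ℚ) → History m
  play done        w = []
  play (query e k) w = (e , w e) ∷ play (k (w e)) w

  asked : History m → Subset m
  asked = foldr (λ p S → ⁅ proj₁ p ⁆ ∪ S) ⊥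

  next : Strategy m → History m → Maybe (Fin m)
  next done        _             = nothing
  next (query e _) []            = just e
  next (query e k) ((_ , v) ∷ h) = next (k v) h

run-play : (A : Algorithm) → ∀ {n m} (G : Instance n m) (ŵ w : Fin m → ℚ) (s : Strategy m) →
  (∀ h → A G ŵ h ≡ next s h) → ∃ λ k → run A G ŵ w k ≡ play s w
run-play A {m = m} G ŵ w s follows = go s [] 0 refl λ _ → refl
  where
  -- `t` is the subtree reached along the history `h`; the last argument keeps `next s` after `h` in
  -- step with `next t`.
  go : ∀ t h k → run A G ŵ w k ≡ h → (∀ h' → next s (h ++ h') ≡ next t h') → ∃ λ k' → run A G ŵ w k' ≡ h ++ play t w
  go done        h k eq tail = k , trans eq (sym (++-identityʳ h))
  go (query e c) h k eq tail =
    let (k' , eq') = go (c (w e)) (h ++ (e , w e) ∷ []) (suc k) eq₁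
                       λ h' → trans (cong (next s) (++-assoc h _ h')) (tail ((e , w e) ∷ h'))
    in k' , trans eq' (++-assoc h _ _)
    where
    eq₁ : run A G ŵ w (suc k) ≡ h ++ (e , w e) ∷ []
    eq₁ rewrite eq | follows h | trans (cong (next s) (sym (++-identityʳ h))) (tail []) = refl

∈Opens⁻ : ∀ {m} (K : Fin m → Interval) {e} → e ∈ Opens K → IsOpen (K e)
∈Opens⁻ K = ∈⟦⟧⁻ (isOpen? ∘ K)

∈Opens⁺ : ∀ {m} (K : Fin m → Interval) {e} → IsOpen (K e) → e ∈ Opens K
∈Opens⁺ K = ∈⟦⟧⁺ (isOpen? ∘ K)

reveal₁ : ∀ {m} → (Fin m → Interval) → Fin m → ℚ → Fin m → Interval
reveal₁ K e v = reveal K ⁅ e ⁆ (λ _ → v)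

module _ {m} (K : Fin m → Interval) (e : Fin m) where

  reveal₁-open : ∀ {v g} → IsOpen (reveal₁ K e v g) → IsOpen (K g) × g ≢ e
  reveal₁-open o = let (o' , g∉) = reveal-open K o in o' , x∉⁅y⁆⇒x≢y g∉

  reveal₁-valid : ∀ {w} → ValidIn K w → ValidIn (reveal₁ K e (w e)) w
  reveal₁-valid {w} = reveal-valid K (cong w ∘ sym ∘ x∈⁅y⁆⇒x≡y e)

  reveal₁-⊆ : ∀ {v} → v ∈ᴵ K e → ∀ {g x} → x ∈ᴵ reveal₁ K e v g → x ∈ᴵ K g
  reveal₁-⊆ {v} v∈ = reveal-⊆ K λ g∈ → subst (λ g → v ∈ᴵ K g) (sym (x∈⁅y⁆⇒x≡y e g∈)) v∈

-- The unit of all charging: `R` is the set of edges not yet charged, and removing a witness set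
-- from it removes a member of every feasible `Q`.
∣∩∣-drop : ∀ {m} {Q R R' : Subset m} {x} → x ∈ Q → x ∈ R → R' ⊆ R → x ∉ R' → suc ∣ Q ∩ R' ∣ ℕ.≤ ∣ Q ∩ R ∣
∣∩∣-drop {Q = Q} {R} {R'} {x} x∈Q x∈R R'⊆R x∉R' = p⊂q⇒∣p∣<∣q∣
  ( (λ y∈ → x∈p∩q⁺ (proj₁ (x∈p∩q⁻ Q R' y∈) , R'⊆R (proj₂ (x∈p∩q⁻ Q R' y∈))))
  , x , x∈p∩q⁺ (x∈Q , x∈R) , x∉R' ∘ proj₂ ∘ x∈p∩q⁻ Q R')

charge : ∀ {a b c} → a ℕ.≤ 2 ℕ.* b → suc b ℕ.≤ c → 2 ℕ.+ a ℕ.≤ 2 ℕ.* c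
charge {a} {b} {c} a≤ b<c = begin
  2 ℕ.+ a          ≤⟨ ℕ.+-monoʳ-≤ 2 a≤ ⟩
  2 ℕ.+ 2 ℕ.* b    ≡⟨ ℕ.*-suc 2 b ⟨
  2 ℕ.* suc b      ≤⟨ ℕ.*-monoʳ-≤ 2 b<c ⟩
  2 ℕ.* c          ∎
  where open ℕ.≤-Reasoning

-- Settling an arbitrary revealed instance by witness pairs.

module Strategies {m} (Base : Subset m → Set) (base? : Decidable Base)
  (exch : ∀ {T T' e} → Base T → Base T' → e ∈ T → e ∉ T' →
     ∃ λ f → f ∈ T' × f ∉ T × Base (swap T e f) × Base (swap T' f e))
  (wt : (Fin m → ℚ) → Subset m → ℚ)
  (wt-swap : ∀ x {T e f} → e ∈ T → f ∉ T → wt x (swap T e f) + x e ≡ wt x T + x f)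
  (base : ∃ Base) where

  open WeightedBases Base base? exch wt wt-swap public

  -- If `f` is known already, the second alternative of `witness` is void and the pair forces `e`
  -- alone.
  record WitnessPair (K : Fin m → Interval) (e f : Fin m) : Set where
    field
      first-open : IsOpen (K e)
      witness    : ∀ {w Q} → ValidIn K w → FeasibleIn K w Q → e ∈ Q ⊎ InPlay K Q f
  open WitnessPair

  Ambiguous : (Fin m → Interval) → Subset m → Set
  Ambiguous K T = ∃ λ e → ∃ λ f → e ∈ T × f ∉ T × Base (swap T e f) × lo (K f) < hi (K e)

  ambiguous⇒witnessPair : ∀ {K T} → Base T → LowerOptimal K T → Ambiguous K T → ∃ λ e → ∃ λ f → WitnessPair K e f
  ambiguous⇒witnessPair {K} bT lower (e , f , e∈T , f∉T , b , lof<hie) with highest-on-cycle lower e∈T f∉T b lof<hie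
  ... | c , c∈T , bc , e≤c , greatest = c , f , record
    { first-open = c-open
    ; witness    = λ valid feasible → treeEdge-witness valid feasible bT c∈T f∉T bc c-open (lower c _ c∈T) greatest lof<hic
    }
    where
    lof<hic : lo (K f) < hi (K c)
    lof<hic = <-≤-trans lof<hie e≤c
    c-open : IsOpen (K c)
    c-open = open-above lower c∈T f∉T bc lof<hic

  unambiguous⇒resolved : ∀ {K T} → ¬ Ambiguous K T → Resolved K T
  unambiguous⇒resolved unambiguous e∈T f∉T b = ≮⇒≥ λ lof<hie → unambiguous (_ , _ , e∈T , f∉T , b , lof<hie)

  abstract
    ambiguous? : ∀ K T → Dec (Ambiguous K T)
    ambiguous? K T =
      any? λ e → any? λ f → (e ∈? T) ×-dec (¬? (f ∈? T) ×-dec (base? (swap T e f) ×-dec (lo (K f) <? hi (K e))))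

    -- A lower optimal tree is computed afresh for each `K`. Either a remaining conflict yields a
    -- pair via the highest edge on its cycle, or no conflict is left and the tree is optimal for
    -- all realisations.
    witnessPair? : ∀ K → (∃ λ e → ∃ λ f → WitnessPair K e f) ⊎ (∃ λ T → Base T × Resolved K T)
    witnessPair? K = let (T , bT , lower) = lowerOptimal K base in
      [ inj₁ ∘ ambiguous⇒witnessPair bT lower , (λ ¬amb → inj₂ (T , bT , λ {e} {f} → unambiguous⇒resolved {K} ¬amb {e} {f})) ]′ (toSum (ambiguous? K T))

  settle : ℕ → (Fin m → Interval) → Strategy m
  settleSecond : ℕ → ∀ K f → Dec (IsOpen (K f)) → (Fin m → Interval) → Strategy m

  -- Never reached when the fuel exceeds the number of open intervals, since every round closes at
  -- least one.
  settle zero    K = done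
  settle (suc k) K with witnessPair? K
  ... | inj₂ _           = done
  ... | inj₁ (e , f , _) = query e λ v → settleSecond k K f (isOpen? (K f)) (reveal₁ K e v)

  settleSecond k K f (no _)  K' = settle k K'
  settleSecond k K f (yes _) K' = query f λ v → settle k (reveal₁ K' f v)

  reveal₁-feasible : ∀ {K w Q} e → ValidIn K w → FeasibleIn K w Q → FeasibleIn (reveal₁ K e (w e)) w Q
  reveal₁-feasible {w = w} e = feasible-reveal (cong w ∘ sym ∘ x∈⁅y⁆⇒x≡y e)

  query-feasible : ∀ {K w Q} e → FeasibleIn (reveal₁ K e (w e)) w Q → FeasibleIn K w (⁅ e ⁆ ∪ Q)
  query-feasible {w = w} e = feasible-unreveal (cong w ∘ sym ∘ x∈⁅y⁆⇒x≡y e)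

  -- `cost` counts only open members of `Q`: later pairs are charged to edges that are still open,
  -- so no member is charged twice.
  record Settles (s : Strategy m) (K : Fin m → Interval) (w : Fin m → ℚ) : Set where
    field
      feasible : FeasibleIn K w (asked (play s w))
      cost     : ∀ {Q} → FeasibleIn K w Q → length (play s w) ℕ.≤ 2 ℕ.* ∣ Q ∩ Opens K ∣
  open Settles

  settle-settles : ∀ k {K w} → ValidIn K w → ∣ Opens K ∣ ℕ.< k → Settles (settle k K) K w
  settle-settles (suc k) {K} {w} valid (s≤s fuel) with witnessPair? K
  ... | inj₂ (T , bT , resolved) = record { feasible = resolved⇒feasible bT resolved ; cost = λ _ → z≤n }
  ... | inj₁ (e , f , pair) with isOpen? (K f)
  ...   | no ¬open-f = record
    { feasible = query-feasible e (feasible rest)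
    ; cost     = λ {Q} feas → ℕ.≤-trans (ℕ.n≤1+n _) (charge (cost rest (reveal₁-feasible e valid feas)) (paid feas))
    }
    where
    K' = reveal₁ K e (w e)
    smaller : Opens K' ⊂ Opens K
    smaller = (λ g∈ → ∈Opens⁺ K (proj₁ (reveal₁-open K e (∈Opens⁻ K' g∈)))) , e , ∈Opens⁺ K (first-open pair) ,
              λ e∈ → proj₂ (reveal₁-open K e (∈Opens⁻ K' e∈)) refl
    rest : Settles (settle k K') K' w
    rest = settle-settles k (reveal₁-valid K e valid) (ℕ.≤-trans (p⊂q⇒∣p∣<∣q∣ smaller) fuel)
    paid : ∀ {Q} → FeasibleIn K w Q → suc ∣ Q ∩ Opens K' ∣ ℕ.≤ ∣ Q ∩ Opens K ∣
    paid feas with witness pair valid feas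
    ... | inj₁ e∈Q          = ∣∩∣-drop e∈Q (proj₁ (proj₂ (proj₂ smaller))) (proj₁ smaller) (proj₂ (proj₂ (proj₂ smaller)))
    ... | inj₂ (_ , open-f) = contradiction open-f ¬open-f
  ...   | yes open-f = record
    { feasible = query-feasible e (query-feasible f (feasible rest))
    ; cost     = λ {Q} feas → charge (cost rest (reveal₁-feasible f valid' (reveal₁-feasible e valid feas))) (paid feas)
    }
    where
    K' = reveal₁ K e (w e)
    K'' = reveal₁ K' f (w f)
    valid' = reveal₁-valid K e valid
    opened : ∀ {g} → g ∈ Opens K'' → IsOpen (K g) × g ≢ e
    opened {g} g∈ = reveal₁-open K e {g = g} (proj₁ (reveal₁-open K' f {g = g} (∈Opens⁻ K'' g∈)))
    ⊆K : Opens K'' ⊆ Opens K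
    ⊆K g∈ = ∈Opens⁺ K (proj₁ (opened g∈))
    e∉ : e ∉ Opens K''
    e∉ e∈ = proj₂ (opened e∈) refl
    f∉ : f ∉ Opens K''
    f∉ f∈ = proj₂ (reveal₁-open K' f (∈Opens⁻ K'' f∈)) refl
    rest : Settles (settle k K'') K'' w
    rest = settle-settles k (reveal₁-valid K' f valid')
             (ℕ.≤-trans (p⊂q⇒∣p∣<∣q∣ (⊆K , e , ∈Opens⁺ K (first-open pair) , e∉)) fuel)
    paid : ∀ {Q} → FeasibleIn K w Q → suc ∣ Q ∩ Opens K'' ∣ ℕ.≤ ∣ Q ∩ Opens K ∣
    paid feas with witness pair valid feas
    ... | inj₁ e∈Q            = ∣∩∣-drop e∈Q (∈Opens⁺ K (first-open pair)) ⊆K e∉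
    ... | inj₂ (f∈Q , open-f) = ∣∩∣-drop f∈Q (∈Opens⁺ K open-f) ⊆K f∉

  repair : List (Fin m) → (Fin m → Interval) → Strategy m
  repair []       K = settle (suc m) K
  repair (q ∷ qs) K = query q λ v → repair qs (reveal₁ K q v)

  repair-feasible : ∀ qs {K w} → ValidIn K w → FeasibleIn K w (asked (play (repair qs K) w))
  repair-feasible []       {K} valid = feasible (settle-settles (suc m) valid (s≤s (∣p∣≤n (Opens K))))
  repair-feasible (q ∷ qs) {K} valid = query-feasible q (repair-feasible qs (reveal₁-valid K q valid))

  -- The listed edges are paid for by `length qs`. Once they are revealed, every open edge lies in
  -- `R`, and settling charges only there.
  repair-cost : ∀ qs {K w Q R} → ValidIn K w → FeasibleIn K w Q → (∀ {e} → IsOpen (K e) → e ∈ R ⊎ e List.∈ qs) →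
    length (play (repair qs K) w) ℕ.≤ length qs ℕ.+ 2 ℕ.* ∣ Q ∩ R ∣
  repair-cost [] {K} {w} {Q} {R} valid feas open⊆ = ℕ.≤-trans
    (cost (settle-settles (suc m) valid (s≤s (∣p∣≤n (Opens K)))) feas)
    (ℕ.*-monoʳ-≤ 2 (p⊆q⇒∣p∣≤∣q∣ λ e∈ → x∈p∩q⁺ (proj₁ (x∈p∩q⁻ Q _ e∈) , inR (open⊆ (∈Opens⁻ K (proj₂ (x∈p∩q⁻ Q _ e∈)))))))
    where
    inR : ∀ {e} → e ∈ R ⊎ e List.∈ [] → e ∈ R
    inR (inj₁ e∈R) = e∈R
  repair-cost (q ∷ qs) {K} {w} {Q} {R} valid feas open⊆ =
    s≤s (repair-cost qs (reveal₁-valid K q valid) (reveal₁-feasible q valid feas) open⊆')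
    where
    open⊆' : ∀ {e} → IsOpen (reveal₁ K q (w q) e) → e ∈ R ⊎ e List.∈ qs
    open⊆' {e} o with reveal₁-open K q o
    ... | o' , e≢q with open⊆ o'
    ...   | inj₁ e∈R         = inj₁ e∈R
    ...   | inj₂ (here e≡q)  = contradiction e≡q e≢q
    ...   | inj₂ (there e∈)  = inj₂ e∈

-- Trusting the predictions on a vertex cover of the conflict graph

module Trusting {m} (Base : Subset m → Set) (base? : Decidable Base)
  (exch : ∀ {T T' e} → Base T → Base T' → e ∈ T → e ∉ T' →
     ∃ λ f → f ∈ T' × f ∉ T × Base (swap T e f) × Base (swap T' f e))
  (wt : (Fin m → ℚ) → Subset m → ℚ)
  (wt-swap : ∀ x {T e f} → e ∈ T → f ∉ T → wt x (swap T e f) + x e ≡ wt x T + x f)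
  (K₀ : Fin m → Interval) (ŵ : Fin m → ℚ) where

  open WeightedBases Base base? exch wt wt-swap

  Conflict : Subset m → Fin m → Fin m → Set
  Conflict T e f = e ∈ T × f ∉ T × Base (swap T e f) × lo (K₀ f) < hi (K₀ e)

  conflict? : ∀ T e f → Dec (Conflict T e f)
  conflict? T e f = (e ∈? T) ×-dec (¬? (f ∈? T) ×-dec (base? (swap T e f) ×-dec (lo (K₀ f) <? hi (K₀ e))))

  Separating : Subset m → Set
  Separating T = ∀ e f → Conflict T e f → hi (K₀ e) ≤ ŵ f × ŵ e ≤ lo (K₀ f)

  -- A finite, decidable substitute for membership in the class, whose definition speaks of
  -- infinitesimals and of all feasible query sets; see `inClass⇒suitable`.
  Suitable : Subset m → Set
  Suitable T = Base T × LowerOptimal K₀ T × UpperOptimal K₀ T × Separating T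

  abstract
    suitable? : Decidable Suitable
    suitable? T = base? T ×-dec (optimal? _≼ᴸ?_ ×-dec (optimal? _≼ᵁ?_ ×-dec
      all? λ e → all? λ f → conflict? T e f →-dec ((hi (K₀ e) ≤? ŵ f) ×-dec (ŵ e ≤? lo (K₀ f)))))
      where
      optimal? : ∀ {_≼_ : Interval → Interval → Set} → (∀ i j → Dec (i ≼ j)) →
        Dec (∀ e f → e ∈ T → f ∉ T → Base (swap T e f) → K₀ e ≼ K₀ f)
      optimal? _≼?_ = all? λ e → all? λ f → (e ∈? T) →-dec (¬? (f ∈? T) →-dec (base? (swap T e f) →-dec (K₀ e ≼? K₀ f)))

  module _ {T} (bT : Base T) {w} (valid : ValidIn K₀ w) {e f} (e∈T : e ∈ T) (f∉T : f ∉ T) (b : Base (swap T e f)) where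

    -- Reveal `f`. The value is still below the upper limit of `e`, so the highest edge `c` on the
    -- cycle and `f` form a witness pair; as `f` is now a point, `c` itself is forced.
    mandatory-tree : LowerOptimal K₀ T → w f < hi (K₀ e) → ∃ λ c → ∀ {Q} → FeasibleIn K₀ w Q → c ∈ Q
    mandatory-tree lower wf<hie =
      let (c , c∈T , bc , e≤c , greatest) = highest-on-cycle lower' e∈T f∉T b lof<hie
          lof<hic = <-≤-trans lof<hie e≤c
      in c , λ feas → [ id , (λ (_ , open-f) → contradiction refl (proj₂ (reveal₁-open K₀ f {g = f} open-f))) ]′
        (treeEdge-witness (reveal₁-valid K₀ f valid) (feasible-reveal (cong w ∘ sym ∘ x∈⁅y⁆⇒x≡y f) valid feas) bT c∈T f∉T bc
          (open-above lower' c∈T f∉T bc lof<hic) (lower' c _ c∈T) greatest lof<hic)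
      where
      K = reveal₁ K₀ f (w f)
      Kf≡ : K f ≡ point (w f)
      Kf≡ = reveal-∈ K₀ (λ _ → w f) (x∈⁅x⁆ f)
      K≡ : ∀ {g} → g ≢ f → K g ≡ K₀ g
      K≡ g≢f = reveal-∉ K₀ (λ _ → w f) (x≢y⇒x∉⁅y⁆ g≢f)
      -- Revealing the non-tree edge `f` can only raise its lower limit.
      lower' : LowerOptimal K T
      lower' c g c∈T g∉T b' with g ≟ f
      ... | no g≢f   = subst₂ _≼ᴸ_ (sym (K≡ (∈∧∉⇒≢ c∈T f∉T))) (sym (K≡ g≢f)) (lower c g c∈T g∉T b')
      ... | yes refl = subst₂ _≼ᴸ_ (sym (K≡ (∈∧∉⇒≢ c∈T f∉T))) (sym Kf≡)
        ( ≤-trans (proj₁ (lower c g c∈T g∉T b')) (lo≤∈ (K₀ g) (valid g))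
        , λ open-c _ → ≼ᴸ⇒lo<∈ open-c (lower c g c∈T g∉T b') (valid g))
      lof<hie : lo (K f) < hi (K e)
      lof<hie = subst₂ (λ i j → lo i < hi j) (sym Kf≡) (sym (K≡ (∈∧∉⇒≢ e∈T f∉T))) wf<hie

    -- Dually, revealing `e` above the lower limit of `f` forces the lowest edge in the cut of `e`;
    -- `T` stays upper optimal because upper limits only drop.
    mandatory-nonTree : UpperOptimal K₀ T → lo (K₀ f) < w e → ∃ λ g → ∀ {Q} → FeasibleIn K₀ w Q → g ∈ Q
    mandatory-nonTree upper lof<we =
      let (g , g∉T , bg , g≤f , least) = lowest-in-cut upper' e∈T f∉T b lof<hie
          log<hie = ≤-<-trans g≤f lof<hie
      in g , λ feas → [ id , (λ (_ , open-e) → contradiction refl (proj₂ (reveal₁-open K₀ e {g = e} open-e))) ]′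
        (nonTreeEdge-witness (reveal₁-valid K₀ e valid) (feasible-reveal (cong w ∘ sym ∘ x∈⁅y⁆⇒x≡y e) valid feas) bT e∈T g∉T bg
          (open-below upper' e∈T g∉T bg log<hie) (λ c∈T → upper' _ g c∈T g∉T) least log<hie)
      where
      K = reveal₁ K₀ e (w e)
      Ke≡ : K e ≡ point (w e)
      Ke≡ = reveal-∈ K₀ (λ _ → w e) (x∈⁅x⁆ e)
      K≡ : ∀ {g} → g ≢ e → K g ≡ K₀ g
      K≡ g≢e = reveal-∉ K₀ (λ _ → w e) (x≢y⇒x∉⁅y⁆ g≢e)
      upper' : UpperOptimal K T
      upper' c g c∈T g∉T b' with c ≟ e
      ... | no c≢e   = subst₂ _≼ᵁ_ (sym (K≡ c≢e)) (sym (K≡ (∈∧∉⇒≢ e∈T g∉T ∘ sym))) (upper c g c∈T g∉T b')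
      ... | yes refl = subst₂ _≼ᵁ_ (sym Ke≡) (sym (K≡ (∈∧∉⇒≢ e∈T g∉T ∘ sym)))
        ( ≤-trans (∈≤hi (K₀ c) (valid c)) (proj₁ (upper c g c∈T g∉T b'))
        , λ _ open-g → ≼ᵁ⇒∈<hi open-g (upper c g c∈T g∉T b') (valid c))
      lof<hie : lo (K f) < hi (K e)
      lof<hie = subst₂ (λ i j → lo i < hi j) (sym (K≡ (∈∧∉⇒≢ e∈T f∉T ∘ sym))) (sym Ke≡) lof<we

  module _ {T} (suitable : Suitable T) where

    private
      bT = proj₁ suitable
      lower = proj₁ (proj₂ suitable)
      upper = proj₁ (proj₂ (proj₂ suitable))
      separating = proj₂ (proj₂ (proj₂ suitable))

    open Strategies Base base? exch wt wt-swap (T , bT)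
      using (repair; repair-feasible; repair-cost; reveal₁-feasible; query-feasible)

    _~_ : Fin m → Fin m → Set
    x ~ y = Conflict T x y ⊎ Conflict T y x

    abstract
      cover : CoverWithMatching _~_
      cover = könig (λ x y → conflict? T x y ⊎-dec conflict? T y x) T Sum.swap
        (λ { (inj₁ (_ , y∉T , _)) _ y∈T → y∉T y∈T ; (inj₂ (_ , x∉T , _)) x∈T _ → x∉T x∈T })
        (λ { (inj₁ (x∈T , _)) x∉T → contradiction x∈T x∉T ; (inj₂ (y∈T , _)) _ → y∈T })

    open CoverWithMatching cover

    conflict-open : ∀ {e f} → Conflict T e f → IsOpen (K₀ e) × IsOpen (K₀ f)
    conflict-open {e} {f} (e∈T , f∉T , b , lof<hie) =
      open-above lower e∈T f∉T b lof<hie , open-below upper e∈T f∉T b lof<hie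

    ~-open : ∀ {x y} → x ~ y → IsOpen (K₀ x) × IsOpen (K₀ y)
    ~-open (inj₁ c) = conflict-open c
    ~-open (inj₂ c) = Product.swap (conflict-open c)

    -- Tree edges are queried by decreasing upper limit, the others by increasing lower limit.
    key : Fin m → ℚ
    key e with e ∈? T
    ... | yes _ = ℚ.- hi (K₀ e)
    ... | no _  = lo (K₀ e)

    key-tree : ∀ {c p} → c ∈ T → p ∈ T → hi (K₀ p) < hi (K₀ c) → key c < key p
    key-tree {c} {p} c∈T p∈T hip<hic with c ∈? T | p ∈? T
    ... | yes _   | yes _   = neg-antimono-< hip<hic
    ... | no c∉T  | _       = contradiction c∈T c∉T
    ... | yes _   | no p∉T  = contradiction p∈T p∉T

    key-nonTree : ∀ {c p} → c ∉ T → p ∉ T → lo (K₀ c) < lo (K₀ p) → key c < key p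
    key-nonTree {c} {p} c∉T p∉T loc<lop with c ∈? T | p ∈? T
    ... | no _    | no _    = loc<lop
    ... | yes c∈T | _       = contradiction c∈T c∉T
    ... | no _    | yes p∈T = contradiction p∈T p∉T

    -- One order interleaves both sides of the cover; the witness arguments invoke it between
    -- elements of the same side.
    PredictedBefore : (Fin m → ℚ) → Fin m → Set
    PredictedBefore w p = ∀ {c} → c ∈ C → key c < key p → ŵ c ≡ w c

    -- Reveal the earlier cover elements on the side of p. As they are correctly predicted, T stays optimal for both limits,
    -- and p becomes extremal among the conflicts of its partner, since these all lie in the cover.
    tree-pair-witness : ∀ {w Q p f} → ValidIn K₀ w → FeasibleIn K₀ w Q → f ∉ C → Conflict T p f →
      PredictedBefore w p → p ∈ Q ⊎ f ∈ Q
    tree-pair-witness {w} {Q} {p} {f} valid feasible f∉C conflict@(p∈T , f∉T , b , lof<hip) before =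
      Sum.map id proj₁ (treeEdge-witness (reveal-valid K₀ ŵ≡w valid) (feasible-reveal ŵ≡w valid feasible) bT p∈T f∉T b
        (subst IsOpen (sym Kp≡) (proj₁ (conflict-open conflict))) least greatest
        (subst₂ (λ i j → lo i < hi j) (sym (unrevealed f∉T)) (sym Kp≡) lof<hip))
      where
      earlier? : Decidable λ c → c ∈ C × c ∈ T × hi (K₀ p) < hi (K₀ c)
      earlier? c = (c ∈? C) ×-dec ((c ∈? T) ×-dec (hi (K₀ p) <? hi (K₀ c)))
      S = ⟦ earlier? ⟧
      K = reveal K₀ S ŵ
      ŵ≡w : ∀ {c} → c ∈ S → ŵ c ≡ w c
      ŵ≡w c∈S = let (c∈C , c∈T , hip<hic) = ∈⟦⟧⁻ earlier? c∈S in before c∈C (key-tree c∈T p∈T hip<hic)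
      unrevealed : ∀ {g} → g ∉ T → K g ≡ K₀ g
      unrevealed g∉T = reveal-∉ K₀ ŵ λ g∈S → g∉T (proj₁ (proj₂ (∈⟦⟧⁻ earlier? g∈S)))
      Kp≡ : K p ≡ K₀ p
      Kp≡ = reveal-∉ K₀ ŵ λ p∈S → <-irrefl refl (proj₂ (proj₂ (∈⟦⟧⁻ earlier? p∈S)))
      least : ∀ {g} → g ∉ T → Base (swap T p g) → K p ≼ᴸ K g
      least g∉T b' = subst₂ _≼ᴸ_ (sym Kp≡) (sym (unrevealed g∉T)) (lower p _ p∈T g∉T b')
      ≼ᵁKp : ∀ {i} → hi i < hi (K₀ p) → i ≼ᵁ K p
      ≼ᵁKp i<p = subst (_ ≼ᵁ_) (sym Kp≡) (<⇒≤ i<p , λ _ _ → i<p)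
      greatest : ∀ {c} → c ∈ T → Base (swap T c f) → K c ≼ᵁ K p
      -- A revealed `c` has value at most `lo (K₀ f)` by `separating`; a `c` without conflict with
      -- `f` has its upper limit there; any other `c` lies in `C`, as `f` does not, and was left
      -- unrevealed because its upper limit does not exceed that of `p`.
      greatest {c} c∈T b' with c ∈? S
      ... | yes c∈S = ≼ᵁKp (≤-<-trans (proj₂ (separating c f (c∈T , f∉T , b' ,
                        <-trans lof<hip (proj₂ (proj₂ (∈⟦⟧⁻ earlier? c∈S)))))) lof<hip)
      ... | no c∉S with lo (K₀ f) <? hi (K₀ c)
      ...   | no lof≮hic  = ≼ᵁKp (≤-<-trans (≮⇒≥ lof≮hic) lof<hip)
      ...   | yes lof<hic with covers (inj₁ (c∈T , f∉T , b' , lof<hic))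
      ...     | inj₂ f∈C = contradiction f∈C f∉C
      ...     | inj₁ c∈C = subst (K₀ c ≼ᵁ_) (sym Kp≡)
        ( ≮⇒≥ (λ hip<hic → c∉S (∈⟦⟧⁺ earlier? (c∈C , c∈T , hip<hic)))
        , λ ¬open-c _ → contradiction (proj₁ (conflict-open (c∈T , f∉T , b' , lof<hic))) ¬open-c)

    -- Mirror image of `tree-pair-witness`: cover elements outside `T` with smaller lower limit are
    -- revealed, and by `separating` those in the cut of `e` jump to at least `hi (K₀ e)`, beyond
    -- `lo (K₀ p)`.
    nonTree-pair-witness : ∀ {w Q p e} → ValidIn K₀ w → FeasibleIn K₀ w Q → e ∉ C → Conflict T e p →
      PredictedBefore w p → p ∈ Q ⊎ e ∈ Q
    nonTree-pair-witness {w} {Q} {p} {e} valid feasible e∉C conflict@(e∈T , p∉T , b , lop<hie) before =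
      Sum.map id proj₁ (nonTreeEdge-witness (reveal-valid K₀ ŵ≡w valid) (feasible-reveal ŵ≡w valid feasible) bT e∈T p∉T b
        (subst IsOpen (sym Kp≡) (proj₂ (conflict-open conflict))) greatest least
        (subst₂ (λ i j → lo i < hi j) (sym Kp≡) (sym (unrevealed e∈T)) lop<hie))
      where
      earlier? : Decidable λ c → c ∈ C × c ∉ T × lo (K₀ c) < lo (K₀ p)
      earlier? c = (c ∈? C) ×-dec (¬? (c ∈? T) ×-dec (lo (K₀ c) <? lo (K₀ p)))
      S = ⟦ earlier? ⟧
      K = reveal K₀ S ŵ
      ŵ≡w : ∀ {c} → c ∈ S → ŵ c ≡ w c
      ŵ≡w c∈S = let (c∈C , c∉T , loc<lop) = ∈⟦⟧⁻ earlier? c∈S in before c∈C (key-nonTree c∉T p∉T loc<lop)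
      unrevealed : ∀ {g} → g ∈ T → K g ≡ K₀ g
      unrevealed g∈T = reveal-∉ K₀ ŵ λ g∈S → proj₁ (proj₂ (∈⟦⟧⁻ earlier? g∈S)) g∈T
      Kp≡ : K p ≡ K₀ p
      Kp≡ = reveal-∉ K₀ ŵ λ p∈S → <-irrefl refl (proj₂ (proj₂ (∈⟦⟧⁻ earlier? p∈S)))
      greatest : ∀ {g} → g ∈ T → Base (swap T g p) → K g ≼ᵁ K p
      greatest g∈T b' = subst₂ _≼ᵁ_ (sym (unrevealed g∈T)) (sym Kp≡) (upper _ p g∈T p∉T b')
      Kp≼ᴸ : ∀ {i} → lo (K₀ p) < lo i → K p ≼ᴸ i
      Kp≼ᴸ p<i = subst (_≼ᴸ _) (sym Kp≡) (<⇒≤ p<i , λ _ _ → p<i)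
      least : ∀ {c} → c ∉ T → Base (swap T e c) → K p ≼ᴸ K c
      least {c} c∉T b' with c ∈? S
      ... | yes c∈S = Kp≼ᴸ (<-≤-trans lop<hie (proj₁ (separating e c (e∈T , c∉T , b' ,
                        <-trans (proj₂ (proj₂ (∈⟦⟧⁻ earlier? c∈S))) lop<hie))))
      ... | no c∉S with lo (K₀ c) <? hi (K₀ e)
      ...   | no loc≮hie  = Kp≼ᴸ (<-≤-trans lop<hie (≮⇒≥ loc≮hie))
      ...   | yes loc<hie with covers (inj₁ (e∈T , c∉T , b' , loc<hie))
      ...     | inj₁ e∈C = contradiction e∈C e∉C
      ...     | inj₂ c∈C = subst (_≼ᴸ K₀ c) (sym Kp≡)
        ( ≮⇒≥ (λ loc<lop → c∉S (∈⟦⟧⁺ earlier? (c∈C , c∉T , loc<lop)))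
        , λ _ ¬open-c → contradiction (proj₂ (conflict-open (e∈T , c∉T , b' , loc<hie))) ¬open-c)

    pair-witness : ∀ {w Q p} → ValidIn K₀ w → FeasibleIn K₀ w Q → p ∈ C → PredictedBefore w p → p ∈ Q ⊎ partner p ∈ Q
    pair-witness valid feasible p∈C before with adjacent p∈C
    ... | inj₁ conflict = tree-pair-witness valid feasible (partner∉ p∈C) conflict before
    ... | inj₂ conflict = nonTree-pair-witness valid feasible (partner∉ p∈C) conflict before

    FirstIn : Subset m → Fin m → Set
    FirstIn X p = p ∈ X × (∀ {c} → c ∈ X → key p ≤ key c)

    abstract
      first? : ∀ X → ∃ (FirstIn X) ⊎ Empty X
      first? X with minimiser _≤_ ≤-total ≤-trans key (_∈? X) (allFin m)
      ... | inj₁ (p , p∈X , min) = inj₁ (p , p∈X , min (∈-allFin _))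
      ... | inj₂ none            = inj₂ λ (x , x∈X) → none (∈-allFin x) x∈X

    -- X holds the cover elements still to be queried, and hs the partners of those already queried.
    trust : ℕ → Subset m → List (Fin m) → (Fin m → Interval) → Strategy m
    respond : ∀ {v u : ℚ} → Dec (v ≡ u) → ℕ → Subset m → List (Fin m) → (Fin m → Interval) → Strategy m

    trust zero    X hs K = done
    trust (suc k) X hs K with first? X
    ... | inj₂ _       = done
    ... | inj₁ (p , _) = query p λ v → respond (v ≟ℚ ŵ p) k (X - p) (partner p ∷ hs) (reveal₁ K p v)

    respond (yes _) k X hs K = trust k X hs K
    respond (no _)  k X hs K = repair hs K

    record Trusted (w : Fin m → ℚ) (X : Subset m) (K : Fin m → Interval) : Set where
      field
        validK   : ValidIn K w
        K⊆K₀     : ∀ {e x} → x ∈ᴵ K e → x ∈ᴵ K₀ e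
        X⊆C      : X ⊆ C
        verified : ∀ {c} → c ∈ C → c ∈ X ⊎ (ŵ c ≡ w c × K c ≡ point (ŵ c))
    open Trusted

    trusted-step : ∀ {w X K p} → Trusted w X K → w p ≡ ŵ p → Trusted w (X - p) (reveal₁ K p (w p))
    trusted-step {w} {X} {K} {p} tr w≡ŵ = record
      { validK   = reveal₁-valid K p (validK tr)
      ; K⊆K₀     = λ {e} x∈ → K⊆K₀ tr (reveal₁-⊆ K p (validK tr p) {g = e} x∈)
      ; X⊆C      = X⊆C tr ∘ x∈p-y⇒x∈p X p
      ; verified = λ {c} c∈C → verified' c∈C
      }
      where
      verified' : ∀ {c} → c ∈ C → c ∈ X - p ⊎ (ŵ c ≡ w c × reveal₁ K p (w p) c ≡ point (ŵ c))
      verified' {c} c∈C with c ≟ p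
      ... | yes refl = inj₂ (sym w≡ŵ , trans (reveal-∈ K (λ _ → w p) (x∈⁅x⁆ p)) (cong point w≡ŵ))
      ... | no c≢p with verified tr c∈C
      ...   | inj₁ c∈X         = inj₁ (x∈p∧x≢y⇒x∈p-y c∈X c≢p)
      ...   | inj₂ (eq , Kc≡)  = inj₂ (eq , trans (reveal-∉ K (λ _ → w p) (x≢y⇒x∉⁅y⁆ c≢p)) Kc≡)

    predictedBefore : ∀ {w X K p} → Trusted w X K → FirstIn X p → PredictedBefore w p
    predictedBefore tr (_ , first) c∈C c<p with verified tr c∈C
    ... | inj₁ c∈X      = contradiction (first c∈X) (<⇒≱ c<p)
    ... | inj₂ (eq , _) = eq

    feasible-K : ∀ {w X K Q} → Trusted w X K → FeasibleIn K₀ w Q → FeasibleIn K w Q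
    feasible-K tr (T' , opt) = T' , λ x x≡w x∈ → opt x x≡w λ e e∉Q → K⊆K₀ tr (x∈ e e∉Q)

    -- Each conflict has an end in the cover, fixed at its predicted value, and `separating` puts
    -- that value on the right side of the entire other interval. Pairs without conflict are ordered
    -- by their limits.
    cover-verified⇒feasible : ∀ {w X K} → Trusted w X K → Empty X → FeasibleIn K w ⊥
    cover-verified⇒feasible {w} {X} {K} tr X∅ = T , λ x _ x∈ → bT , λ {e} {f} e∈T f∉T b → ordered x x∈ e∈T f∉T b
      where
      predicted : ∀ x → (∀ e → e ∉ ⊥ → x e ∈ᴵ K e) → ∀ {c} → c ∈ C → x c ≡ ŵ c
      predicted x x∈ {c} c∈C with verified tr c∈C
      ... | inj₁ c∈X       = contradiction (c , c∈X) X∅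
      ... | inj₂ (_ , Kc≡) = subst (x c ∈ᴵ_) Kc≡ (x∈ c ∉⊥)
      ordered : ∀ x → (∀ e → e ∉ ⊥ → x e ∈ᴵ K e) → ∀ {e f} → e ∈ T → f ∉ T → Base (swap T e f) → x e ≤ x f
      ordered x x∈ {e} {f} e∈T f∉T b with lo (K₀ f) <? hi (K₀ e)
      ... | no lof≮hie = ≤-trans (∈≤hi (K₀ e) (K⊆K₀ tr (x∈ e ∉⊥))) (≤-trans (≮⇒≥ lof≮hie) (lo≤∈ (K₀ f) (K⊆K₀ tr (x∈ f ∉⊥))))
      ... | yes lof<hie with covers (inj₁ (e∈T , f∉T , b , lof<hie)) | separating e f (e∈T , f∉T , b , lof<hie)
      ...   | inj₁ e∈C | _ , ŵe≤lof = ≤-trans (≤-reflexive (predicted x x∈ e∈C)) (≤-trans ŵe≤lof (lo≤∈ (K₀ f) (K⊆K₀ tr (x∈ f ∉⊥))))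
      ...   | inj₂ f∈C | hie≤ŵf , _ = ≤-trans (∈≤hi (K₀ e) (K⊆K₀ tr (x∈ e ∉⊥))) (≤-trans hie≤ŵf (≤-reflexive (sym (predicted x x∈ f∈C))))

    trust-feasible : ∀ k {w X hs K} → Trusted w X K → ∣ X ∣ ℕ.< k → FeasibleIn K w (asked (play (trust k X hs K) w))
    trust-feasible (suc k) {w} {X} {hs} {K} tr (s≤s fuel) with first? X
    ... | inj₂ X∅ = cover-verified⇒feasible tr X∅
    ... | inj₁ (p , p∈X , _) with w p ≟ℚ ŵ p
    ...   | yes w≡ŵ = query-feasible p (trust-feasible k (trusted-step tr w≡ŵ) (ℕ.≤-trans (x∈p⇒∣p-x∣<∣p∣ p∈X) fuel))
    ...   | no _    = query-feasible p (repair-feasible (partner p ∷ hs) (reveal₁-valid K p (validK tr)))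

    -- R consists of the open edges outside the pairs {p, partner p} of the queried cover elements p.
    record Reserve (X R : Subset m) : Set where
      field
        X⊆R        : X ⊆ R
        partner∈R  : ∀ {x} → x ∈ X → partner x ∈ R
    open Reserve

    module _ {w X K p R} (tr : Trusted w X K) (first : FirstIn X p) (res : Reserve X R) where

      private
        p∈X = proj₁ first
        p∈C = X⊆C tr p∈X

      -- The pairs are disjoint: partners lie outside `C` and are distinct, so removing the pair of
      -- `p` leaves all pending pairs intact.
      reserve-step : Reserve (X - p) (R - p - partner p)
      reserve-step = record
        { X⊆R       = λ x∈ → x∈p∧x≢y⇒x∈p-y (x∈p∧x≢y⇒x∈p-y (X⊆R res (x∈p-y⇒x∈p X p x∈)) (x∈p-y⇒x≢y X p x∈))
                        λ { refl → partner∉ p∈C (X⊆C tr (x∈p-y⇒x∈p X p x∈)) }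
        ; partner∈R = λ x∈ → let x∈X = x∈p-y⇒x∈p X p x∈ in
                        x∈p∧x≢y⇒x∈p-y (x∈p∧x≢y⇒x∈p-y (partner∈R res x∈X)
                          (λ eq → partner∉ (X⊆C tr x∈X) (subst (_∈ C) (sym eq) p∈C)))
                          (x∈p-y⇒x≢y X p x∈ ∘ injective (X⊆C tr x∈X) p∈C)
        }

      reserve-drop : ∀ {Q} → ValidIn K₀ w → FeasibleIn K₀ w Q → suc ∣ Q ∩ (R - p - partner p) ∣ ℕ.≤ ∣ Q ∩ R ∣
      reserve-drop valid feas with pair-witness valid feas p∈C (predictedBefore tr first)
      ... | inj₁ p∈Q = ∣∩∣-drop p∈Q (X⊆R res p∈X) (x∈p-y⇒x∈p R p ∘ x∈p-y⇒x∈p (R - p) (partner p))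
                         λ p∈ → x∈p-y⇒x≢y R p (x∈p-y⇒x∈p (R - p) (partner p) p∈) refl
      ... | inj₂ h∈Q = ∣∩∣-drop h∈Q (partner∈R res p∈X) (x∈p-y⇒x∈p R p ∘ x∈p-y⇒x∈p (R - p) (partner p))
                         λ h∈ → x∈p-y⇒x≢y (R - p) (partner p) h∈ refl

    -- The term `length hs` is a deposit. Each pair is charged two queries for its member in `Q`:
    -- one pays for `p`, the other is saved for its partner and spent only if a repair becomes
    -- necessary. The charge relies on earlier predictions alone, so it also covers the `p` that
    -- triggers the repair.
    trust-robust : ∀ k {w X hs K R Q} → Trusted w X K → ∣ X ∣ ℕ.< k → Reserve X R → ValidIn K₀ w → FeasibleIn K₀ w Q →
      (∀ {e} → IsOpen (K e) → e ∈ R ⊎ e List.∈ hs) →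
      length (play (trust k X hs K) w) ℕ.≤ length hs ℕ.+ 2 ℕ.* ∣ Q ∩ R ∣
    trust-robust (suc k) {w} {X} {hs} {K} {R} {Q} tr (s≤s fuel) res valid feas open⊆ with first? X
    ... | inj₂ X∅ = z≤n
    ... | inj₁ (p , first) = ℕ.≤-trans (s≤s (rest (w p ≟ℚ ŵ p))) budget
      where
      R' = R - p - partner p
      open⊆' : ∀ {e} → IsOpen (reveal₁ K p (w p) e) → e ∈ R' ⊎ e List.∈ partner p ∷ hs
      open⊆' {e} o with reveal₁-open K p {g = e} o | e ≟ partner p
      ... | _ | yes e≡h = inj₂ (here e≡h)
      ... | o' , e≢p | no e≢h = Sum.map (λ e∈R → x∈p∧x≢y⇒x∈p-y (x∈p∧x≢y⇒x∈p-y e∈R e≢p) e≢h) there (open⊆ o')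
      rest : (d : Dec (w p ≡ ŵ p)) → length (play (respond d k (X - p) (partner p ∷ hs) (reveal₁ K p (w p))) w)
                                       ℕ.≤ suc (length hs) ℕ.+ 2 ℕ.* ∣ Q ∩ R' ∣
      rest (yes w≡ŵ) = trust-robust k (trusted-step tr w≡ŵ) (ℕ.≤-trans (x∈p⇒∣p-x∣<∣p∣ (proj₁ first)) fuel)
                         (reserve-step tr first res) valid feas open⊆'
      rest (no _)    = repair-cost (partner p ∷ hs) (reveal₁-valid K p (validK tr))
                         (reveal₁-feasible p (validK tr) (feasible-K tr feas)) open⊆'
      budget : 2 ℕ.+ length hs ℕ.+ 2 ℕ.* ∣ Q ∩ R' ∣ ℕ.≤ length hs ℕ.+ 2 ℕ.* ∣ Q ∩ R ∣
      budget = begin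
        2 ℕ.+ length hs ℕ.+ 2 ℕ.* ∣ Q ∩ R' ∣      ≡⟨ cong (ℕ._+ 2 ℕ.* ∣ Q ∩ R' ∣) (ℕ.+-comm 2 (length hs)) ⟩
        length hs ℕ.+ 2 ℕ.+ 2 ℕ.* ∣ Q ∩ R' ∣      ≡⟨ ℕ.+-assoc (length hs) 2 _ ⟩
        length hs ℕ.+ (2 ℕ.+ 2 ℕ.* ∣ Q ∩ R' ∣)    ≤⟨ ℕ.+-monoʳ-≤ (length hs) (charge ℕ.≤-refl (reserve-drop tr first res valid feas)) ⟩
        length hs ℕ.+ 2 ℕ.* ∣ Q ∩ R ∣             ∎
        where open ℕ.≤-Reasoning

    -- Without a repair the deposit is never spent, leaving one query per disjoint witness pair.
    trust-consistent : ∀ k {w X hs K R Q} → Trusted w X K → ∣ X ∣ ℕ.< k → Reserve X R → ValidIn K₀ w → FeasibleIn K₀ w Q →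
      (∀ e → ŵ e ≡ w e) → length (play (trust k X hs K) w) ℕ.≤ ∣ Q ∩ R ∣
    trust-consistent (suc k) {w} {X} {hs} {K} {R} {Q} tr (s≤s fuel) res valid feas ŵ≡w with first? X
    ... | inj₂ X∅ = z≤n
    ... | inj₁ (p , first) with w p ≟ℚ ŵ p
    ...   | no w≢ŵ  = contradiction (sym (ŵ≡w p)) w≢ŵ
    ...   | yes w≡ŵ = ℕ.≤-trans (s≤s (trust-consistent k (trusted-step tr w≡ŵ) (ℕ.≤-trans (x∈p⇒∣p-x∣<∣p∣ (proj₁ first)) fuel)
                        (reserve-step tr first res) valid feas ŵ≡w)) (reserve-drop tr first res valid feas)

    strategy : Strategy m
    strategy = trust (suc m) C [] K₀

    trusted₀ : ∀ {w} → ValidIn K₀ w → Trusted w C K₀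
    trusted₀ valid = record { validK = valid ; K⊆K₀ = id ; X⊆C = id ; verified = inj₁ }

    reserve₀ : Reserve C (Opens K₀)
    reserve₀ = record { X⊆R = λ x∈ → ∈Opens⁺ K₀ (proj₁ (~-open (adjacent x∈))) ; partner∈R = λ x∈ → ∈Opens⁺ K₀ (proj₂ (~-open (adjacent x∈))) }

    module _ {w} (valid : ValidIn K₀ w) where

      strategy-feasible : FeasibleIn K₀ w (asked (play strategy w))
      strategy-feasible = trust-feasible (suc m) (trusted₀ valid) (s≤s (∣p∣≤n C))

      strategy-robust : ∀ {Q} → FeasibleIn K₀ w Q → length (play strategy w) ℕ.≤ 2 ℕ.* ∣ Q ∣
      strategy-robust {Q} feas = ℕ.≤-trans
        (trust-robust (suc m) (trusted₀ valid) (s≤s (∣p∣≤n C)) reserve₀ valid feas (inj₁ ∘ ∈Opens⁺ K₀))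
        (ℕ.*-monoʳ-≤ 2 (∣p∩q∣≤∣p∣ Q (Opens K₀)))

      strategy-consistent : (∀ e → ŵ e ≡ w e) → ∀ {Q} → FeasibleIn K₀ w Q → length (play strategy w) ℕ.≤ 1 ℕ.* ∣ Q ∣
      strategy-consistent ŵ≡w {Q} feas = ℕ.≤-trans
        (trust-consistent (suc m) (trusted₀ valid) (s≤s (∣p∣≤n C)) reserve₀ valid feas ŵ≡w)
        (ℕ.≤-trans (∣p∩q∣≤∣p∣ Q (Opens K₀)) (ℕ.≤-reflexive (sym (ℕ.*-identityˡ ∣ Q ∣))))

-- From instances to intervals

toInterval : (b : Bool) (l u : ℚ) → (b ≡ false → l < u) → Interval
toInterval true  l u _   = point l
toInterval false l u l<u = interval l u (l<u refl)

toInterval-∈⁺ : ∀ b {l u l<u x} → (b ≡ true × x ≡ l) ⊎ (b ≡ false × (l < x × x < u)) → x ∈ᴵ toInterval b l u l<u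
toInterval-∈⁺ true  (inj₁ (_ , x≡l)) = x≡l
toInterval-∈⁺ true  (inj₂ (() , _))
toInterval-∈⁺ false (inj₁ (() , _))
toInterval-∈⁺ false (inj₂ (_ , x∈))  = x∈

toInterval-∈⁻ : ∀ b {l u l<u x} → x ∈ᴵ toInterval b l u l<u → (b ≡ true × x ≡ l) ⊎ (b ≡ false × (l < x × x < u))
toInterval-∈⁻ true  x≡l = inj₁ (refl , x≡l)
toInterval-∈⁻ false x∈  = inj₂ (refl , x∈)

module _ where
  open +-*-Solver

  p+[q-p] : ∀ p q → p + (q ℚ.- p) ≡ q
  p+[q-p] = solve 2 (λ p q → p :+ (q :- p) := q) refl

  p-q+q : ∀ p q → p ℚ.- q + q ≡ p
  p-q+q = solve 2 (λ p q → p :- q :+ q := p) refl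

≤-ε⇒+ε≤ : ∀ {p q ε} → p ≤ q ℚ.- ε → p + ε ≤ q
≤-ε⇒+ε≤ {p} {q} {ε} le = ≤-trans (+-monoˡ-≤ ε le) (≤-reflexive (p-q+q q ε))

-ε≤⇒≤+ε : ∀ {p q ε} → p ℚ.- ε ≤ q → p ≤ q + ε
-ε≤⇒≤+ε {p} {q} {ε} le = ≤-trans (≤-reflexive (sym (p-q+q p ε))) (+-monoˡ-≤ ε le)

p<p+ε : ∀ p {ε} → 0ℚ < ε → p < p + ε
p<p+ε p 0<ε = subst (_< p + _) (+-identityʳ p) (+-monoʳ-< p 0<ε)

module _ {δ} (0<δ : 0ℚ < δ) where

  ≤-limit : ∀ {p q} → (∀ ε → 0ℚ < ε → ε < δ → p ≤ q + ε) → p ≤ q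
  ≤-limit {p} {q} le = ≮⇒≥ λ q<p →
    let 0<p-q = subst (_< p ℚ.- q) (+-inverseʳ q) (+-monoˡ-< (ℚ.- q) q<p)
        (ε , 0<ε , ε<δ , ε<p-q) = dense-⊓ 0<δ 0<p-q
    in <⇒≱ (subst (q + ε <_) (p+[q-p] q p) (+-monoʳ-< q ε<p-q)) (le ε 0<ε ε<δ)

  <-limit : ∀ {p q} → (∀ ε → 0ℚ < ε → ε < δ → p + ε ≤ q) → p < q
  <-limit {p} le = let (ε , 0<ε , ε<δ) = <-dense 0<δ in <-≤-trans (p<p+ε p 0<ε) (le ε 0<ε ε<δ)

  -- Letting ε tend to 0 gives the weak inequality. If only the left side is shifted, the inequality
  -- at a single positive ε is already strict.
  lowerW⇒≼ᴸ : ∀ b b' {l l' u u' l<u l<u'} →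
    (∀ ε → 0ℚ < ε → ε < δ → (if b then l else l + ε) ≤ (if b' then l' else l' + ε)) →
    toInterval b l u l<u ≼ᴸ toInterval b' l' u' l<u'
  lowerW⇒≼ᴸ true  true  le = (let (ε , 0<ε , ε<δ) = <-dense 0<δ in le ε 0<ε ε<δ) , λ ()
  lowerW⇒≼ᴸ true  false le = ≤-limit le , λ ()
  lowerW⇒≼ᴸ false true  le = <⇒≤ (<-limit le) , λ _ _ → <-limit le
  lowerW⇒≼ᴸ false false {l} le = ≤-limit (λ ε 0<ε ε<δ → ≤-trans (<⇒≤ (p<p+ε l 0<ε)) (le ε 0<ε ε<δ)) ,
                                 λ _ ¬open → contradiction isOpen ¬open

  upperW⇒≼ᵁ : ∀ b b' {l l' u u' l<u l<u'} → (b ≡ true → l ≡ u) → (b' ≡ true → l' ≡ u') →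
    (∀ ε → 0ℚ < ε → ε < δ → (if b then u else u ℚ.- ε) ≤ (if b' then u' else u' ℚ.- ε)) →
    toInterval b l u l<u ≼ᵁ toInterval b' l' u' l<u'
  upperW⇒≼ᵁ true  true  l≡u l≡u' le with l≡u refl | l≡u' refl
  ... | refl | refl = (let (ε , 0<ε , ε<δ) = <-dense 0<δ in le ε 0<ε ε<δ) , λ _ ()
  upperW⇒≼ᵁ true  false l≡u _ le with l≡u refl
  ... | refl = <⇒≤ u<u' , λ _ _ → u<u'
    where u<u' = <-limit λ ε 0<ε ε<δ → ≤-ε⇒+ε≤ (le ε 0<ε ε<δ)
  upperW⇒≼ᵁ false true  _ l≡u' le with l≡u' refl
  ... | refl = ≤-limit (λ ε 0<ε ε<δ → -ε≤⇒≤+ε (le ε 0<ε ε<δ)) , λ _ ()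
  upperW⇒≼ᵁ false false {u' = u'} _ _ le =
    ≤-limit (λ ε 0<ε ε<δ → ≤-trans (-ε≤⇒≤+ε (le ε 0<ε ε<δ)) (≤-trans (≤-reflexive (p-q+q u' ε)) (<⇒≤ (p<p+ε u' 0<ε)))) ,
    λ ¬open _ → contradiction isOpen ¬open

module _ {n m} (G : Instance n m) where
  open Instance G

  intervals : Fin m → Interval
  intervals e = toInterval (trivial e) (L e) (U e) (open-LU e)

  Valid⇒ValidIn : ∀ {w} → Valid G w → ValidIn intervals w
  Valid⇒ValidIn valid e = toInterval-∈⁺ (trivial e) (valid e)

-- The algorithm on instances.

module InstanceStrategy {n m} (G : Instance n m) (ŵ : Fin m → ℚ) where
  open Instance G
  open WeightedBases (IsSpanningTree G) (isSpanningTree? G) (exchange G) (weight G) (weight-swap G)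
  open Trusting (IsSpanningTree G) (isSpanningTree? G) (exchange G) (weight G) (weight-swap G) (intervals G) ŵ

  Feasible⇒FeasibleIn : ∀ {w Q} → Feasible G w Q → FeasibleIn (intervals G) w Q
  Feasible⇒FeasibleIn (T , mst) = T , λ x x≡w x∈ →
    minimal⇒optimal (mst x x≡w λ e e∉Q → toInterval-∈⁻ (trivial e) (x∈ e e∉Q))

  FeasibleIn⇒Feasible : ∀ {w Q} → FeasibleIn (intervals G) w Q → Feasible G w Q
  FeasibleIn⇒Feasible (T , opt) = T , λ x x≡w x∈ →
    optimal⇒minimal (opt x x≡w λ e e∉Q → toInterval-∈⁺ (trivial e) (x∈ e e∉Q))

  lowerLimit⇒lowerOptimal : ∀ {T} → IsLowerLimitTree G T → LowerOptimal (intervals G) T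
  lowerLimit⇒lowerOptimal (δ , 0<δ , mst) e f e∈T f∉T b = lowerW⇒≼ᴸ 0<δ (trivial e) (trivial f)
    λ ε 0<ε ε<δ → proj₂ (minimal⇒optimal (mst ε 0<ε ε<δ)) e∈T f∉T b

  upperLimit⇒upperOptimal : ∀ {T} → IsUpperLimitTree G T → UpperOptimal (intervals G) T
  upperLimit⇒upperOptimal (δ , 0<δ , mst) e f e∈T f∉T b = upperW⇒≼ᵁ 0<δ (trivial e) (trivial f) (trivial-LU e) (trivial-LU f)
    λ ε 0<ε ε<δ → proj₂ (minimal⇒optimal (mst ε 0<ε ε<δ)) e∈T f∉T b

  -- The mandatory-edge lemmas are applied with the predictions as true weights: a conflict
  -- violating `Separating` would produce a prediction mandatory edge.
  inClass⇒suitable : Valid G ŵ → InClass G ŵ → ∃ Suitable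
  inClass⇒suitable valid (_ , free , T , (lowerTree , _) , (upperTree , _)) = T , bT , lower , upper , λ e f (e∈T , f∉T , b , _) →
    ≮⇒≥ (λ ŵf<hie → let (c , mandatory) = mandatory-tree bT (Valid⇒ValidIn G valid) e∈T f∉T b lower ŵf<hie in
      free c λ Q feas → mandatory (Feasible⇒FeasibleIn feas)) ,
    ≮⇒≥ (λ lof<ŵe → let (g , mandatory) = mandatory-nonTree bT (Valid⇒ValidIn G valid) e∈T f∉T b upper lof<ŵe in
      free g λ Q feas → mandatory (Feasible⇒FeasibleIn feas))
    where
    lower = lowerLimit⇒lowerOptimal lowerTree
    upper = upperLimit⇒upperOptimal upperTree
    bT : IsSpanningTree G T
    bT = let (δ , 0<δ , mst) = lowerTree ; (ε , 0<ε , ε<δ) = <-dense 0<δ in proj₁ (mst ε 0<ε ε<δ)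

  choose : Dec (∃ Suitable) → Strategy m
  choose (yes (_ , suitable)) = strategy suitable
  -- A default for inputs outside the class; within it a suitable tree exists.
  choose (no _)               = done

  choose-feasible : ∀ d {w} → ∃ Suitable → Valid G w → Feasible G w (asked (play (choose d) w))
  choose-feasible (yes (_ , suitable)) _      valid = FeasibleIn⇒Feasible (strategy-feasible suitable (Valid⇒ValidIn G valid))
  choose-feasible (no none)            exists _     = contradiction exists none

  choose-robust : ∀ d {w Q} → Valid G w → Feasible G w Q → length (play (choose d) w) ℕ.≤ 2 ℕ.* ∣ Q ∣
  choose-robust (yes (_ , suitable)) valid feas = strategy-robust suitable (Valid⇒ValidIn G valid) (Feasible⇒FeasibleIn feas)
  choose-robust (no _)               _     _    = z≤n

  choose-consistent : ∀ d {w Q} → Valid G w → (∀ e → ŵ e ≡ w e) → Feasible G w Q → length (play (choose d) w) ℕ.≤ 1 ℕ.* ∣ Q ∣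
  choose-consistent (yes (_ , suitable)) valid ŵ≡w feas =
    strategy-consistent suitable (Valid⇒ValidIn G valid) ŵ≡w (Feasible⇒FeasibleIn feas)
  choose-consistent (no _)               _     _   _    = z≤n

  abstract
    existsSuitable? : Dec (∃ Suitable)
    existsSuitable? = anySubset? suitable?

  chosen : Strategy m
  chosen = choose existsSuitable?

algorithm : Algorithm
algorithm G ŵ = next (InstanceStrategy.chosen G ŵ)

competitive : ∀ {n m} (G : Instance n m) (ŵ w : Fin m → ℚ) ρ → Valid G w → Valid G ŵ → InClass G ŵ →
  (∀ {Q} → Feasible G w Q → length (play (InstanceStrategy.chosen G ŵ) w) ℕ.≤ ρ ℕ.* ∣ Q ∣) → Competitive algorithm G ŵ w ρ
competitive G ŵ w ρ valid validŵ inClass cost =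
  let (k , eq) = run-play algorithm G ŵ w chosen (λ _ → refl) in
  k , subst (λ h → Feasible G w (asked h)) (sym eq) (choose-feasible existsSuitable? (inClass⇒suitable validŵ inClass) valid) ,
  λ Q feas → subst (λ h → length h ℕ.≤ ρ ℕ.* ∣ Q ∣) (sym eq) (cost feas)
  where open InstanceStrategy G ŵ

theorem4p3 : Σ Algorithm λ A →
    (∀ {n m} (G : Instance n m) (ŵ w : Fin m → ℚ) →
    Valid G w → Valid G ŵ → InClass G ŵ →
    (∀ e → ŵ e ≡ w e) → Competitive A G ŵ w 1)
    ×
    (∀ {n m} (G : Instance n m) (ŵ w : Fin m → ℚ) →
    Valid G w → Valid G ŵ → InClass G ŵ →
    Competitive A G ŵ w 2)
theorem4p3 = algorithm ,
  (λ G ŵ w valid validŵ inClass ŵ≡w → competitive G ŵ w 1 valid validŵ inClass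
    (InstanceStrategy.choose-consistent G ŵ (InstanceStrategy.existsSuitable? G ŵ) valid ŵ≡w)) ,
  (λ G ŵ w valid validŵ inClass → competitive G ŵ w 2 valid validŵ inClass
    (InstanceStrategy.choose-robust G ŵ (InstanceStrategy.existsSuitable? G ŵ) valid))
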